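{- Fix an integer $k\ge 4$ and suppose there exists a counterexample for $k$. If there exists a bad graph on $n$ vertices, then either $k=4$ and $n\le 12$, or $k\ge 5$ and $n\le 2k-2$.
   Context: Graphs are finite, simple, undirected; $P_H(k)$ is the number of proper $k$-colorings of $H$; the $2$-core of $H$ is obtained by repeatedly deleting vertices of degree at most one. A counterexample for $k$ is a connected graph $H$ with $\chi(H)=k$ such that either $P_H(k)>k!(k-1)^{|V(H)|-k}$, or $P_H(k)=k!(k-1)^{|V(H)|-k}$ and the $2$-core of $H$ is not a $k$-clique. Let $n_0$ be the minimum number of vertices of a counterexample for $k$. A graph $G$ is bad if it is a counterexample for $k$ with exactly $n_0$ vertices and no proper subgraph of $G$ is a counterexample for $k$. -}

module Defs where

open import Data.Nat using (ℕ; zero; suc; _+_; _*_; _∸_; _^_; _≤_; _<_; _≤ᵇ_)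
open import Data.Nat using (_!)
open import Data.Bool using (Bool; true; false; _∧_; _∨_; not; if_then_else_)
open import Data.Fin using (Fin; _≟_)
open import Data.Fin.Subset using (Subset; ∣_∣)
open import Data.Vec using (Vec; []; _∷_; lookup; tabulate)
open import Data.List using (List; []; _∷_; map; concatMap; allFin; length; filter)
open import Data.Nat.ListAction using (sum)
open import Data.Product using (Σ; _×_; _,_; ∃)
open import Data.Sum using (_⊎_)
open import Data.Empty using (⊥)
open import Relation.Nullary using (¬_; does)
open import Relation.Binary.PropositionalEquality using (_≡_; _≢_)
open import Function.Definitions using (Injective)

record Graph (n : ℕ) : Set where
  field
    adj    : Fin n → Fin n → Bool
    sym    : ∀ u v → adj u v ≡ adj v u
    irrefl : ∀ v → adj v v ≡ false
open Graph public

Adj : ∀ {n} → Graph n → Fin n → Fin n → Set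
Adj G u v = adj G u v ≡ true

data Reach {n : ℕ} (G : Graph n) : Fin n → Fin n → Set where
  here : ∀ {u} → Reach G u u
  step : ∀ {u v w} → Adj G u v → Reach G v w → Reach G u w

Connected : ∀ {n} → Graph n → Set
Connected {n} G = ∀ (u v : Fin n) → Reach G u v

ProperColoring : ∀ {n} → Graph n → (k : ℕ) → (Fin n → Fin k) → Set
ProperColoring {n} G k c = ∀ (u v : Fin n) → Adj G u v → c u ≢ c v

Colorable : ∀ {n} → Graph n → ℕ → Set
Colorable {n} G k = Σ (Fin n → Fin k) (ProperColoring G k)

ChromaticNumber : ∀ {n} → Graph n → ℕ → Set
ChromaticNumber G k = Colorable G k × (∀ j → j < k → ¬ Colorable G j)

allVecs : (n k : ℕ) → List (Vec (Fin k) n)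
allVecs zero    k = [] ∷ []
allVecs (suc n) k = concatMap (λ c → map (c ∷_) (allVecs n k)) (allFin k)

isProper : ∀ {n k} → Graph n → Vec (Fin k) n → Bool
isProper {n} G c =
  allB (λ u → allB (λ v → not (adj G u v) ∨ not (does (lookup c u ≟ lookup c v))))
  where
    allB : (Fin n → Bool) → Bool
    allB p = Data.List.foldr (λ x b → p x ∧ b) true (allFin n)

chromPoly : ∀ {n} → Graph n → ℕ → ℕ
chromPoly {n} G k = length (filter (λ c → Data.Bool._≟_ (isProper G c) true) (allVecs n k))

degIn : ∀ {n} → Graph n → Subset n → Fin n → ℕ
degIn {n} G S v = sum (map (λ u → if lookup S u ∧ adj G v u then 1 else 0) (allFin n))

coreStep : ∀ {n} → Graph n → Subset n → Subset n
coreStep G S = tabulate (λ v → lookup S v ∧ (2 ≤ᵇ degIn G S v))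

iterateN : ∀ {A : Set} → ℕ → (A → A) → A → A
iterateN zero    f x = x
iterateN (suc m) f x = iterateN m f (f x)

-- vertex set of the 2-core (n rounds suffice: each non-stable round removes a vertex)
twoCore : ∀ {n} → Graph n → Subset n
twoCore {n} G = iterateN n (coreStep G) (tabulate (λ _ → true))

TwoCoreIsClique : ∀ {n} → Graph n → ℕ → Set
TwoCoreIsClique {n} G k =
  ∣ twoCore G ∣ ≡ k ×
  (∀ (u v : Fin n) → lookup (twoCore G) u ≡ true → lookup (twoCore G) v ≡ true
     → u ≢ v → Adj G u v)

Counterexample : ℕ → ∀ {n} → Graph n → Set
Counterexample k {n} G =
  Connected G × ChromaticNumber G k ×
  ( (k ! * (k ∸ 1) ^ (n ∸ k) < chromPoly G k)
  ⊎ (chromPoly G k ≡ k ! * (k ∸ 1) ^ (n ∸ k) × ¬ TwoCoreIsClique G k))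

ProperSubgraph : ∀ {m n} → Graph m → Graph n → Set
ProperSubgraph {m} {n} H G =
  Σ (Fin m → Fin n) λ f →
    Injective _≡_ _≡_ f ×
    (∀ u v → Adj H u v → Adj G (f u) (f v)) ×
    ( (∃ λ (w : Fin n) → ∀ u → f u ≢ w)
    ⊎ (∃ λ (x : Fin n) → ∃ λ (y : Fin n) → Adj G x y ×
         (∀ u v → f u ≡ x → f v ≡ y → ¬ Adj H u v)))

MinCounterexampleOrder : ℕ → ℕ → Set
MinCounterexampleOrder k n0 =
  (Σ (Graph n0) (Counterexample k)) ×
  (∀ m (H : Graph m) → Counterexample k H → n0 ≤ m)

Bad : ℕ → ∀ {n} → Graph n → Set
Bad k {n} G =
  Counterexample k G × MinCounterexampleOrder k n ×
  (∀ m (H : Graph m) → ProperSubgraph H G → ¬ Counterexample k H)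

{-# OPTIONS --safe #-}
module Submission where

-- Write m = k - 1 and let G be a minimal counterexample on n vertices with P colourings.
-- By minimality identifying vertices shows that three given vertices get the same colour in at most
-- P / m² colourings, and that every proper induced subgraph is m-colourable, so that each vertex v has
-- three distinct neighbours x, y, z.
-- For an order of the vertices let a(v, c) be the number of colours not used by c on the earlier
-- neighbours of v. A random greedy colouring produces c with probability ∏ᵥ 1 / a(v, c); hence P is at
-- most the geometric mean of ∏ᵥ a(v, c) over all c, and also over all orders.
-- Since χ(G) = k, each colour class of c contains a frozen vertex, which sees all other colours. Over
-- random orders its factor a(v, c) has geometric mean at most (k!)^(1/k), because all ranks among
-- v and k - 1 neighbours of distinct colours are equally likely. For the other n - k vertices the rank
-- of v among v, x, y, z gives the geometric mean (k m m (m - 1))^(1/4) < m, unless x, y, z have the same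
-- colour, when it is (k m m m)^(1/4). If n is large, the latter case is too rare to matter, and
-- P < k! m^(n-k), a contradiction.

open import Defs
open import Algebra.Bundles using (CommutativeSemigroup)
import Algebra.Properties.CommutativeSemigroup
open import Algebra.Structures using (IsCommutativeMonoid)
open import Data.Bool using (Bool; true; false; _∧_; _∨_; not; if_then_else_)
import Data.Bool as Bool
open import Data.Bool.Properties using (T-≡; ∨-zeroʳ; ∧-comm; ∧-zeroʳ)
open import Data.Empty using (⊥; ⊥-elim)
open import Data.Fin using (Fin; zero; suc; toℕ; punchIn; punchOut; inject≤; _≟_)
open import Data.Fin.Properties using (all?; any?; ¬∀⟶∃¬; toℕ-injective; punchInᵢ≢i; punchIn-punchOut; punchIn-injective; punchOut-injective; inject≤-injective)
open import Data.Fin.Subset using (Subset; ∣_∣)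
open import Data.List using (List; []; _∷_; map; concatMap; cartesianProductWith; allFin; length; filter; _++_; foldr)
open import Data.List.Membership.Propositional using (_∈_)
open import Data.List.Membership.Propositional.Properties using (∈-allFin; ∈-concatMap⁺; ∈-map⁺; ∈-map⁻; ∈-filter⁺; ∈-filter⁻)
open import Data.List.Membership.Propositional.Properties.WithK using (unique∧set⇒bag)
open import Data.List.Properties using (length-tabulate; map-tabulate)
open import Data.List.Relation.Binary.BagAndSetEquality using (∼bag⇒↭)
open import Data.List.Relation.Binary.Permutation.Propositional using (_↭_)
import Data.List.Relation.Binary.Permutation.Propositional as Perm
open import Data.List.Relation.Unary.All using ([])
open import Data.List.Relation.Unary.AllPairs using ([]; _∷_)
open import Data.List.Relation.Unary.Any using (here; there)
import Data.List.Relation.Unary.Any as Any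
open import Data.List.Relation.Unary.Unique.Propositional using (Unique)
import Data.List.Relation.Unary.Unique.Propositional.Properties as Unique
open import Data.Nat using (ℕ; zero; suc; pred; _+_; _*_; _∸_; _^_; _/_; _!; _≤_; _<_; _≤ᵇ_; _<?_; z≤n; s≤s; NonZero; >-nonZero)
open import Data.Nat.Divisibility using (m≤n⇒m!∣n!; ∣-trans; m∣m*n)
open import Data.Nat.DivMod using (m*[n/m]≡n; m/n*n≤m)
open import Data.Nat.ListAction using (sum)
open import Data.Nat.Properties hiding (_≟_)
open import Data.Nat.Tactic.RingSolver using (solve-∀)
open import Data.Product using (Σ; _×_; _,_; ∃; proj₁; proj₂)
open import Data.Sum using (_⊎_; inj₁; inj₂; [_,_]′)
open import Data.Vec using (Vec; []; _∷_; lookup; tabulate; insertAt)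
open import Data.Vec.Properties using (lookup∘tabulate; tabulate∘lookup; tabulate-cong; insertAt-lookup; insertAt-punchIn; ∷-injective)
open import Function using (_∘_; id)
open import Function.Bundles using (Equivalence; mk⇔)
open import Level using (0ℓ)
open import Relation.Binary.PropositionalEquality using (_≡_; _≢_; refl; trans; cong; cong₂; subst; module ≡-Reasoning) renaming (sym to ≡-sym)
open import Relation.Nullary using (¬_; Dec; yes; no; does; contradiction)
open import Relation.Nullary.Decidable using (map′; _×-dec_; _→-dec_; ¬?; dec-true; dec-false; does-⇔)

-- Everything therefore hinges on the other r = n - k vertices beating m. With p = m - 1, the
-- product k m m p equals m^2 (m^2 - 1), so the fourth power of an ordinary factor is below m^4 by
-- the ratio 1 - 1/m^2, whereas a monochromatic triple costs a factor m/p. Identifying three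
-- vertices costs m^2, so a colouring has on average at most n/m^2 such triples. A counterexample
-- thus needs (m^2/(m^2 - 1))^r ≤ (m/p)^(n/m^2). Raised to the power m^2, where (m^2/(m^2 -
-- 1))^(m^2) > 2, this becomes 2^r < (m/p)^n. It fails for k = 4 and n ≥ 13; it fails for k ≥ 5,
-- where m/p ≤ 4/3, as soon as n ≤ 2r + 1, that is n ≥ 2k - 1. All of this is carried out in the
-- natural numbers: a geometric mean is a product compared with a power, a root is an exponent on
-- the other side, and a quotient is a factor on the other side.

private
  variable
    A C : Set

-- Finite sums and products over lists

module Big (_∙_ : ℕ → ℕ → ℕ) (ε : ℕ) (isCM : IsCommutativeMonoid _≡_ _∙_ ε) where
  private
    module M = IsCommutativeMonoid isCM
    semigroup : CommutativeSemigroup 0ℓ 0ℓ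
    semigroup = record { isCommutativeSemigroup = M.isCommutativeSemigroup }
    open Algebra.Properties.CommutativeSemigroup semigroup using (interchange)

  big : (A → ℕ) → List A → ℕ
  big f []       = ε
  big f (x ∷ xs) = f x ∙ big f xs

  big-cong-∈ : ∀ {f g : A → ℕ} xs → (∀ x → x ∈ xs → f x ≡ g x) → big f xs ≡ big g xs
  big-cong-∈ []       eq = refl
  big-cong-∈ (x ∷ xs) eq = cong₂ _∙_ (eq x (here refl)) (big-cong-∈ xs (λ y y∈ → eq y (there y∈)))

  big-cong : ∀ {f g : A → ℕ} xs → (∀ x → f x ≡ g x) → big f xs ≡ big g xs
  big-cong xs eq = big-cong-∈ xs (λ x _ → eq x)

  big-distrib : ∀ (f g : A → ℕ) xs → big (λ x → f x ∙ g x) xs ≡ big f xs ∙ big g xs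
  big-distrib f g []       = ≡-sym (M.identityˡ ε)
  big-distrib f g (x ∷ xs) = trans (cong ((f x ∙ g x) ∙_) (big-distrib f g xs))
                                   (interchange (f x) (g x) (big f xs) (big g xs))

  big-ε : ∀ (xs : List A) → big (λ _ → ε) xs ≡ ε
  big-ε []       = refl
  big-ε (x ∷ xs) = trans (M.identityˡ _) (big-ε xs)

  big-swap : ∀ (f : A → C → ℕ) xs ys →
    big (λ x → big (f x) ys) xs ≡ big (λ y → big (λ x → f x y) xs) ys
  big-swap f []       ys = ≡-sym (big-ε ys)
  big-swap f (x ∷ xs) ys = trans (cong (big (f x) ys ∙_) (big-swap f xs ys))
                                 (≡-sym (big-distrib (f x) (λ y → big (λ x → f x y) xs) ys))

  big-map : ∀ (f : C → ℕ) (h : A → C) xs → big f (map h xs) ≡ big (f ∘ h) xs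
  big-map f h []       = refl
  big-map f h (x ∷ xs) = cong (f (h x) ∙_) (big-map f h xs)

  big-++ : ∀ (f : A → ℕ) xs ys → big f (xs ++ ys) ≡ big f xs ∙ big f ys
  big-++ f []       ys = ≡-sym (M.identityˡ _)
  big-++ f (x ∷ xs) ys = trans (cong (f x ∙_) (big-++ f xs ys)) (≡-sym (M.assoc (f x) _ _))

  big-concatMap : ∀ (f : C → ℕ) (h : A → List C) xs →
    big f (concatMap h xs) ≡ big (λ x → big f (h x)) xs
  big-concatMap f h []       = refl
  big-concatMap f h (x ∷ xs) = trans (big-++ f (h x) (concatMap h xs))
                                     (cong (big f (h x) ∙_) (big-concatMap f h xs))

  big-↭ : ∀ (f : A → ℕ) {xs ys} → xs ↭ ys → big f xs ≡ big f ys
  big-↭ f Perm.refl           = refl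
  big-↭ f (Perm.prep x p)     = cong (f x ∙_) (big-↭ f p)
  big-↭ f (Perm.trans p q)    = trans (big-↭ f p) (big-↭ f q)
  big-↭ f {_ ∷ _ ∷ xs} {_ ∷ _ ∷ ys} (Perm.swap x y p) = begin
    f x ∙ (f y ∙ big f xs)  ≡⟨ cong (λ t → f x ∙ (f y ∙ t)) (big-↭ f p) ⟩
    f x ∙ (f y ∙ big f ys)  ≡⟨ ≡-sym (M.assoc (f x) (f y) _) ⟩
    (f x ∙ f y) ∙ big f ys  ≡⟨ cong (_∙ big f ys) (M.comm (f x) (f y)) ⟩
    (f y ∙ f x) ∙ big f ys  ≡⟨ M.assoc (f y) (f x) _ ⟩
    f y ∙ (f x ∙ big f ys)  ∎
    where open ≡-Reasoning

  big-allFin : ∀ {n} (f : Fin (suc n) → ℕ) →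
    big f (allFin (suc n)) ≡ f zero ∙ big (f ∘ suc) (allFin n)
  big-allFin {n} f = cong (f zero ∙_)
    (trans (cong (big f) (≡-sym (map-tabulate id suc))) (big-map f suc (allFin n)))

  big-remove : ∀ {n} (f : Fin (suc n) → ℕ) y →
    big f (allFin (suc n)) ≡ f y ∙ big (f ∘ punchIn y) (allFin n)
  big-remove f zero = big-allFin f
  big-remove {suc n} f (suc y) = begin
    big f (allFin (2 + n))                                      ≡⟨ big-allFin f ⟩
    f zero ∙ big (f ∘ suc) (allFin (suc n))                     ≡⟨ cong (f zero ∙_) (big-remove (f ∘ suc) y) ⟩
    f zero ∙ (f (suc y) ∙ R)                                    ≡⟨ ≡-sym (M.assoc _ _ _) ⟩
    (f zero ∙ f (suc y)) ∙ R                                    ≡⟨ cong (_∙ R) (M.comm _ _) ⟩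
    (f (suc y) ∙ f zero) ∙ R                                    ≡⟨ M.assoc _ _ _ ⟩
    f (suc y) ∙ (f zero ∙ R)                                    ≡⟨ cong (f (suc y) ∙_) (≡-sym (big-allFin (f ∘ punchIn (suc y)))) ⟩
    f (suc y) ∙ big (f ∘ punchIn (suc y)) (allFin (suc n))      ∎
    where
    open ≡-Reasoning
    R = big (λ i → f (suc (punchIn y i))) (allFin n)

  big-allVecs : ∀ {n k} (f : Vec (Fin k) (suc n) → ℕ) →
    big f (allVecs (suc n) k) ≡ big (λ a → big (λ c → f (a ∷ c)) (allVecs n k)) (allFin k)
  big-allVecs {n} {k} f = trans (big-concatMap f _ (allFin k))
    (big-cong (allFin k) (λ a → big-map f (a ∷_) (allVecs n k)))

  -- `allVecs` branches on the first entry; here the entry at an arbitrary vertex `y` becomes the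
  -- innermost variable, which is what deleting or merging `y` requires.
  big-insertAt : ∀ {n k} (f : Vec (Fin k) (suc n) → ℕ) y →
    big f (allVecs (suc n) k) ≡ big (λ c → big (λ a → f (insertAt c y a)) (allFin k)) (allVecs n k)
  big-insertAt {n} {k} f zero = trans (big-allVecs f) (big-swap (λ a c → f (a ∷ c)) (allFin k) (allVecs n k))
  big-insertAt {suc n} {k} f (suc y) = begin
    big f (allVecs (2 + n) k)
      ≡⟨ big-allVecs f ⟩
    big (λ b → big (λ c → f (b ∷ c)) (allVecs (suc n) k)) (allFin k)
      ≡⟨ big-cong (allFin k) (λ b → big-insertAt (λ c → f (b ∷ c)) y) ⟩
    big (λ b → big (λ c → big (λ a → f (b ∷ insertAt c y a)) (allFin k)) (allVecs n k)) (allFin k)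
      ≡⟨ ≡-sym (big-allVecs (λ c → big (λ a → f (insertAt c (suc y) a)) (allFin k))) ⟩
    big (λ c → big (λ a → f (insertAt c (suc y) a)) (allFin k)) (allVecs (suc n) k) ∎
    where open ≡-Reasoning

open Big _+_ 0 +-0-isCommutativeMonoid renaming
  ( big to ∑; big-cong to ∑-cong; big-distrib to ∑-distrib; big-swap to ∑-swap
  ; big-map to ∑-map; big-↭ to ∑-↭; big-remove to ∑-remove; big-insertAt to ∑-insertAt; big-ε to ∑-zero
  ; big-allFin to ∑-allFin)
  hiding (big-cong-∈; big-++; big-concatMap; big-allVecs)

open Big _*_ 1 *-1-isCommutativeMonoid renaming
  ( big to ∏; big-cong-∈ to ∏-cong-∈; big-cong to ∏-cong; big-distrib to ∏-distrib; big-swap to ∏-swap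
  ; big-map to ∏-map; big-↭ to ∏-↭; big-remove to ∏-remove)
  hiding (big-++; big-concatMap; big-allVecs; big-insertAt; big-ε; big-allFin)

-- Inequalities for sums and products, up to the AM-GM inequality

∑-mono-∈ : ∀ {f g : A → ℕ} xs → (∀ x → x ∈ xs → f x ≤ g x) → ∑ f xs ≤ ∑ g xs
∑-mono-∈ []       le = z≤n
∑-mono-∈ (x ∷ xs) le = +-mono-≤ (le x (here refl)) (∑-mono-∈ xs (λ y y∈ → le y (there y∈)))

∑-mono : ∀ {f g : A → ℕ} xs → (∀ x → f x ≤ g x) → ∑ f xs ≤ ∑ g xs
∑-mono xs le = ∑-mono-∈ xs (λ x _ → le x)

∏-mono-∈ : ∀ {f g : A → ℕ} xs → (∀ x → x ∈ xs → f x ≤ g x) → ∏ f xs ≤ ∏ g xs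
∏-mono-∈ []       le = ≤-refl
∏-mono-∈ (x ∷ xs) le = *-mono-≤ (le x (here refl)) (∏-mono-∈ xs (λ y y∈ → le y (there y∈)))

∑-const : ∀ a (xs : List A) → ∑ (λ _ → a) xs ≡ length xs * a
∑-const a []       = refl
∑-const a (x ∷ xs) = cong (a +_) (∑-const a xs)

∏-const : ∀ a (xs : List A) → ∏ (λ _ → a) xs ≡ a ^ length xs
∏-const a []       = refl
∏-const a (x ∷ xs) = cong (a *_) (∏-const a xs)

∑-*ˡ : ∀ a (f : A → ℕ) xs → ∑ (λ x → a * f x) xs ≡ a * ∑ f xs
∑-*ˡ a f []       = ≡-sym (*-zeroʳ a)
∑-*ˡ a f (x ∷ xs) = trans (cong (a * f x +_) (∑-*ˡ a f xs)) (≡-sym (*-distribˡ-+ a (f x) _))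

^-distribʳ-* : ∀ a b n → (a * b) ^ n ≡ a ^ n * b ^ n
^-distribʳ-* a b zero    = refl
^-distribʳ-* a b (suc n) = trans (cong (a * b *_) (^-distribʳ-* a b n))
  ([m*n]*[o*p]≡[m*o]*[n*p] a b (a ^ n) (b ^ n))

∏-^ : ∀ (f : A → ℕ) e xs → ∏ (λ x → f x ^ e) xs ≡ ∏ f xs ^ e
∏-^ f e []       = ≡-sym (^-zeroˡ e)
∏-^ f e (x ∷ xs) = trans (cong (f x ^ e *_) (∏-^ f e xs)) (≡-sym (^-distribʳ-* (f x) _ e))

∏-^-∑ : ∀ a (f : A → ℕ) xs → ∏ (λ x → a ^ f x) xs ≡ a ^ ∑ f xs
∏-^-∑ a f []       = refl
∏-^-∑ a f (x ∷ xs) = trans (cong (a ^ f x *_) (∏-^-∑ a f xs)) (≡-sym (^-distribˡ-+-* a (f x) _))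

length-allFin : ∀ n → length (allFin n) ≡ n
length-allFin n = length-tabulate {n = n} id

-- Bernoulli's inequality for the ratio p / q, cleared of denominators and of subtraction.
bernoulli : ∀ p q n → suc n * (p * q ^ n) ≤ p ^ suc n + n * q ^ suc n
bernoulli p q zero = ≤-reflexive (lem p)
  where
  lem : ∀ p → 1 * (p * 1) ≡ p * 1 + 0
  lem = solve-∀
-- Adding n p q^(n+1) to both sides lets the induction step rest on 2pq ≤ p² + q² alone.
bernoulli p q (suc n) = +-cancelˡ-≤ (n * (p * q ^ suc n)) _ _ (begin
  n * (p * q ^ suc n) + (2 + n) * (p * q ^ suc n)        ≡⟨ lem₁ n p q Q ⟩
  suc n * Q * (2 * (p * q))                              ≤⟨ *-monoʳ-≤ (suc n * Q) (2pq≤p²+q² p q) ⟩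
  suc n * Q * (p * p + q * q)                            ≡⟨ lem₂ n p q Q ⟩
  p * (suc n * (p * Q)) + suc n * (q * (q * Q))          ≤⟨ +-monoˡ-≤ _ (*-monoʳ-≤ p (bernoulli p q n)) ⟩
  p * (p ^ suc n + n * q ^ suc n) + suc n * (q * (q * Q)) ≡⟨ lem₃ n p (p ^ suc n) q Q ⟩
  n * (p * q ^ suc n) + (p ^ (2 + n) + suc n * q ^ (2 + n)) ∎)
  where
  open ≤-Reasoning
  Q = q ^ n
  lem₁ : ∀ n p q Q → n * (p * (q * Q)) + (2 + n) * (p * (q * Q)) ≡ suc n * Q * (2 * (p * q))
  lem₁ = solve-∀
  lem₂ : ∀ n p q Q → suc n * Q * (p * p + q * q) ≡ p * (suc n * (p * Q)) + suc n * (q * (q * Q))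
  lem₂ = solve-∀
  lem₃ : ∀ n p R q Q → p * (R + n * (q * Q)) + suc n * (q * (q * Q)) ≡ n * (p * (q * Q)) + (p * R + suc n * (q * (q * Q)))
  lem₃ = solve-∀
  2pq≤p²+q² : ∀ p q → 2 * (p * q) ≤ p * p + q * q
  2pq≤p²+q² zero    q       = z≤n
  2pq≤p²+q² (suc p) zero    = ≤-trans (≤-reflexive (cong (2 *_) (*-zeroʳ (suc p)))) z≤n
  2pq≤p²+q² (suc p) (suc q) = begin
    2 * (suc p * suc q)              ≡⟨ e₁ p q ⟩
    2 * (p * q) + (2 + 2 * p + 2 * q) ≤⟨ +-monoˡ-≤ _ (2pq≤p²+q² p q) ⟩
    (p * p + q * q) + (2 + 2 * p + 2 * q) ≡⟨ e₂ p q ⟩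
    suc p * suc p + suc q * suc q    ∎
    where
    e₁ : ∀ p q → 2 * (suc p * suc q) ≡ 2 * (p * q) + (2 + 2 * p + 2 * q)
    e₁ = solve-∀
    e₂ : ∀ p q → (p * p + q * q) + (2 + 2 * p + 2 * q) ≡ suc p * suc p + suc q * suc q
    e₂ = solve-∀

-- Induction on the length; one more entry `a` in front of a tail with sum `s` costs only the
-- weighted inequality `two-term`, an instance of Bernoulli.
am-gm : ∀ (f : A → ℕ) xs → length xs ^ length xs * ∏ f xs ≤ ∑ f xs ^ length xs
am-gm f []            = ≤-refl
am-gm f (x ∷ [])      = ≤-reflexive (lem (f x))
  where
  lem : ∀ a → 1 * 1 * (a * 1) ≡ (a + 0) * 1
  lem = solve-∀
am-gm f (x ∷ xs@(_ ∷ ys)) = *-cancelˡ-≤ (n ^ n) {{m^n≢0 n n}} (begin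
  n ^ n * (suc n ^ suc n * (a * Π))       ≡⟨ lem₁ (n ^ n) (suc n ^ suc n) a Π ⟩
  suc n ^ suc n * a * (n ^ n * Π)         ≤⟨ *-monoʳ-≤ (suc n ^ suc n * a) (am-gm f xs) ⟩
  suc n ^ suc n * a * s ^ n               ≤⟨ two-term ⟩
  n ^ n * (a + s) ^ suc n                 ∎)
  where
  open ≤-Reasoning
  n = suc (length ys)
  a = f x
  Π = ∏ f xs
  s = ∑ f xs
  lem₁ : ∀ u v a p → u * (v * (a * p)) ≡ v * a * (u * p)
  lem₁ = solve-∀
  -- `p / q` is the ratio of the mean of all entries to the mean of the tail.
  p = n * (a + s)
  q = suc n * s
  two-term : suc n ^ suc n * a * s ^ n ≤ n ^ n * (a + s) ^ suc n
  two-term = *-cancelˡ-≤ n (+-cancelʳ-≤ (n * q ^ suc n) _ _ (begin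
    n * (suc n ^ suc n * a * s ^ n) + n * q ^ suc n
      ≡⟨ cong (λ t → n * (suc n ^ suc n * a * s ^ n) + n * (q * t)) (^-distribʳ-* (suc n) s n) ⟩
    n * (suc n * suc n ^ n * a * s ^ n) + n * (suc n * s * (suc n ^ n * s ^ n))
      ≡⟨ lem₂ n (suc n ^ n) a s (s ^ n) ⟩
    suc n * (n * (a + s) * (suc n ^ n * s ^ n))
      ≡⟨ cong (λ t → suc n * (p * t)) (≡-sym (^-distribʳ-* (suc n) s n)) ⟩
    suc n * (p * q ^ n)
      ≤⟨ bernoulli p q n ⟩
    p ^ suc n + n * q ^ suc n
      ≡⟨ cong (_+ n * q ^ suc n) (^-distribʳ-* n (a + s) (suc n)) ⟩
    n * n ^ n * (a + s) ^ suc n + n * q ^ suc n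
      ≡⟨ cong (_+ n * q ^ suc n) (*-assoc n (n ^ n) _) ⟩
    n * (n ^ n * (a + s) ^ suc n) + n * q ^ suc n ∎))
    where
    lem₂ : ∀ n N a s S → n * (suc n * N * a * S) + n * (suc n * s * (N * S)) ≡ suc n * (n * (a + s) * (N * S))
    lem₂ = solve-∀

-- Indicators, enumeration of proper colourings, and the bound

private
  variable
    𝒫 𝒬 : Set
    n k : ℕ

χ : Dec 𝒫 → ℕ
χ (yes _) = 1
χ (no _)  = 0

χ-mono : (p : Dec 𝒫) (q : Dec 𝒬) → (𝒫 → 𝒬) → χ p ≤ χ q
χ-mono (yes p) (yes q) f = ≤-refl
χ-mono (yes p) (no ¬q) f = contradiction (f p) ¬q
χ-mono (no ¬p) q       f = z≤n

χ-cong : (p : Dec 𝒫) (q : Dec 𝒬) → (𝒫 → 𝒬) → (𝒬 → 𝒫) → χ p ≡ χ q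
χ-cong p q f g = ≤-antisym (χ-mono p q f) (χ-mono q p g)

χ-no : (p : Dec 𝒫) → ¬ 𝒫 → χ p ≡ 0
χ-no (yes p) ¬p = contradiction p ¬p
χ-no (no _)  ¬p = refl

χ-yes : (p : Dec 𝒫) → 𝒫 → χ p ≡ 1
χ-yes (yes _) _ = refl
χ-yes (no ¬p) p = contradiction p ¬p

χ≤1 : (p : Dec 𝒫) → χ p ≤ 1
χ≤1 (yes _) = ≤-refl
χ≤1 (no _)  = z≤n

χ-×-* : (p : Dec 𝒫) (q : Dec 𝒬) → χ (p ×-dec q) ≡ χ p * χ q
χ-×-* (yes _) (yes _) = refl
χ-×-* (yes _) (no _)  = refl
χ-×-* (no _)  (yes _) = refl
χ-×-* (no _)  (no _)  = refl

∑-filter : ∀ {P : A → Set} (P? : ∀ x → Dec (P x)) (f : A → ℕ) xs →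
  ∑ f (filter P? xs) ≡ ∑ (λ x → χ (P? x) * f x) xs
∑-filter P? f []       = refl
∑-filter P? f (x ∷ xs) with P? x
... | yes _ = cong₂ _+_ (≡-sym (+-identityʳ (f x))) (∑-filter P? f xs)
... | no _  = ∑-filter P? f xs

∑χ≟ : ∀ (i : Fin n) → ∑ (λ j → χ (j ≟ i)) (allFin n) ≡ 1
∑χ≟ {suc n} i = begin
  ∑ (λ j → χ (j ≟ i)) (allFin (suc n))                     ≡⟨ ∑-remove (λ j → χ (j ≟ i)) i ⟩
  χ (i ≟ i) + ∑ (λ j → χ (punchIn i j ≟ i)) (allFin n)     ≡⟨ cong₂ _+_ (χ-yes (i ≟ i) refl) (∑-cong (allFin n) (λ j → χ-no (punchIn i j ≟ i) (punchInᵢ≢i i j))) ⟩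
  1 + ∑ (λ _ → 0) (allFin n)                               ≡⟨ cong suc (∑-zero (allFin n)) ⟩
  1                                                        ∎
  where open ≡-Reasoning

allVecs-complete : ∀ (c : Vec (Fin k) n) → c ∈ allVecs n k
allVecs-complete []      = here refl
allVecs-complete (a ∷ c) = ∈-concatMap⁺ _ (Any.map (λ { refl → ∈-map⁺ (a ∷_) (allVecs-complete c) }) (∈-allFin a))

foldr-∧⁻ : ∀ (p : A → Bool) xs → foldr (λ x b → p x ∧ b) true xs ≡ true → ∀ x → x ∈ xs → p x ≡ true
foldr-∧⁻ p (x ∷ xs) eq y y∈ with p x in px | y∈
... | true | here refl = px
... | true | there y∈′ = foldr-∧⁻ p xs eq y y∈′

foldr-∧⁺ : ∀ (p : A → Bool) xs → (∀ x → p x ≡ true) → foldr (λ x b → p x ∧ b) true xs ≡ true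
foldr-∧⁺ p []       h = refl
foldr-∧⁺ p (x ∷ xs) h rewrite h x = foldr-∧⁺ p xs h

isProper-sound : ∀ (G : Graph n) (c : Vec (Fin k) n) → isProper G c ≡ true → ProperColoring G k (lookup c)
isProper-sound {n} G c eq u v uv cu≡cv
  with lookup c u ≟ lookup c v
     | foldr-∧⁻ _ (allFin n) (foldr-∧⁻ _ (allFin n) eq u (∈-allFin u)) v (∈-allFin v)
... | yes _ | h rewrite uv = contradiction h (λ ())
... | no ¬e | h = ¬e cu≡cv

isProper-complete : ∀ (G : Graph n) (c : Vec (Fin k) n) → ProperColoring G k (lookup c) → isProper G c ≡ true
isProper-complete {n} G c pr = foldr-∧⁺ _ (allFin n) (λ u → foldr-∧⁺ _ (allFin n) (λ v → pair u v))
  where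
  pair : ∀ u v → not (adj G u v) ∨ not (does (lookup c u ≟ lookup c v)) ≡ true
  pair u v with adj G u v in uv
  ... | false = refl
  ... | true with lookup c u ≟ lookup c v
  ...   | yes e = contradiction e (pr u v uv)
  ...   | no _  = refl

abstract
  proper? : ∀ (G : Graph n) (c : Vec (Fin k) n) → Dec (ProperColoring G k (lookup c))
  proper? G c = map′ (isProper-sound G c) (isProper-complete G c) (isProper G c Bool.≟ true)

cols : Graph n → ∀ k → List (Vec (Fin k) n)
cols {n} G k = filter (λ c → isProper G c Bool.≟ true) (allVecs n k)

cols-proper : ∀ (G : Graph n) {c : Vec (Fin k) n} → c ∈ cols G k → ProperColoring G k (lookup c)
cols-proper {n} {k} G {c} c∈ = isProper-sound G c (proj₂ (∈-filter⁻ (λ c → isProper G c Bool.≟ true) {xs = allVecs n k} c∈))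

∑-cols : ∀ (G : Graph n) (f : Vec (Fin k) n → ℕ) →
  ∑ f (cols G k) ≡ ∑ (λ c → χ (proper? G c) * f c) (allVecs n k)
∑-cols {n} {k} G f = trans (∑-filter (λ c → isProper G c Bool.≟ true) f (allVecs n k))
  (∑-cong (allVecs n k) (λ c → cong (_* f c) (χ-cong (isProper G c Bool.≟ true) (proper? G c) (isProper-sound G c) (isProper-complete G c))))

chromPoly-∑ : ∀ (G : Graph n) k → chromPoly G k ≡ ∑ (λ c → χ (proper? G c)) (allVecs n k)
chromPoly-∑ {n} G k = begin
  length (cols G k)                                 ≡⟨ ≡-sym (*-identityʳ _) ⟩
  length (cols G k) * 1                             ≡⟨ ≡-sym (∑-const 1 (cols G k)) ⟩
  ∑ (λ _ → 1) (cols G k)                            ≡⟨ ∑-cols G (λ _ → 1) ⟩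
  ∑ (λ c → χ (proper? G c) * 1) (allVecs n k)       ≡⟨ ∑-cong (allVecs n k) (λ c → *-identityʳ _) ⟩
  ∑ (λ c → χ (proper? G c)) (allVecs n k)           ∎
  where open ≡-Reasoning

proper-tabulate : ∀ (G : Graph n) (c : Fin n → Fin k) → ProperColoring G k c → ProperColoring G k (lookup (tabulate c))
proper-tabulate G c pr u v uv eq =
  pr u v uv (trans (≡-sym (lookup∘tabulate c u)) (trans eq (lookup∘tabulate c v)))

colorable? : ∀ (G : Graph n) k → Dec (Colorable G k)
colorable? {n} G k with Any.any? (proper? G) (allVecs n k)
... | yes a = yes (lookup (proj₁ (Any.satisfied a)) , proj₂ (Any.satisfied a))
... | no ¬a = no λ (c , pr) → ¬a (Any.map (λ { refl → proper-tabulate G c pr }) (allVecs-complete (tabulate c)))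

colorable-mono : ∀ (G : Graph n) {j k} → j ≤ k → Colorable G j → Colorable G k
colorable-mono G j≤k (c , pr) = (λ v → inject≤ (c v) j≤k) , λ u v uv eq → pr u v uv (inject≤-injective j≤k j≤k (c u) (c v) eq)

-- With at most `k` vertices all of them can get different colours. The strict inequality is what
-- `bound-suc` needs, so that the exponent in `bound` is not truncated.
uncolorable⇒< : ∀ (G : Graph n) {k} → ¬ Colorable G k → k < n
uncolorable⇒< {n} G {k} ¬col = ≰⇒> λ n≤k → ¬col ((λ v → inject≤ v n≤k) , λ u v uv eq →
  contradiction (trans (≡-sym uv) (trans (cong (adj G u) (≡-sym (inject≤-injective n≤k n≤k u v eq))) (irrefl G u))) (λ ()))

chromatic : ∀ (G : Graph n) {m} → Colorable G (suc m) → ¬ Colorable G m → ChromaticNumber G (suc m)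
chromatic G col ¬col = col , λ { j (s≤s j≤m) c → ¬col (colorable-mono G j≤m c) }

-- Tomescu's bound k!(k-1)^(n-k) for k = m + 1.
bound : ℕ → ℕ → ℕ
bound m n = (suc m) ! * m ^ (n ∸ suc m)

Bounded : ℕ → ℕ → Set
Bounded m n = ∀ (H : Graph n) → Connected H → ¬ Colorable H m → chromPoly H (suc m) ≤ bound m n

-- A graph without any (m+1)-colouring contributes the count 0. Hence chromatic number m+1 relaxes
-- to non-m-colourability, a condition that passes to quotients, unlike (m+1)-colourability.
bounded-of-chromatic : ∀ {m n} →
  (∀ (H : Graph n) → Connected H → ChromaticNumber H (suc m) → chromPoly H (suc m) ≤ bound m n) → Bounded m n
bounded-of-chromatic {m} {n} h H con ¬col with colorable? H (suc m)
... | yes col = h H con (chromatic H col ¬col)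
... | no ¬c = ≤-trans (≤-reflexive (trans (chromPoly-∑ H (suc m)) (trans
  (∑-cong (allVecs n (suc m)) (λ c → χ-no (proper? H c) (λ pr → ¬c (lookup c , pr)))) (∑-zero (allVecs n (suc m)))))) z≤n

bound-suc : ∀ {m n} → m < n → bound m (suc n) ≡ m * bound m n
bound-suc {m} {n} m<n = begin
  (suc m) ! * m ^ (suc n ∸ suc m)          ≡⟨ cong (λ t → (suc m) ! * m ^ t) (∸-suc m<n) ⟩
  (suc m) ! * (m * m ^ (n ∸ suc m))        ≡⟨ lem ((suc m) !) m (m ^ (n ∸ suc m)) ⟩
  m * ((suc m) ! * m ^ (n ∸ suc m))        ∎
  where
  open ≡-Reasoning
  lem : ∀ a b c → a * (b * c) ≡ b * (a * c)
  lem = solve-∀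
  ∸-suc : ∀ {a b} → a < b → b ∸ a ≡ suc (b ∸ suc a)
  ∸-suc {zero}  {suc b} _         = refl
  ∸-suc {suc a} {suc b} (s≤s a<b) = ∸-suc a<b

-- Vertex deletion

delete : Graph (suc n) → Fin (suc n) → Graph n
delete G y = record
  { adj    = λ u v → adj G (punchIn y u) (punchIn y v)
  ; sym    = λ u v → sym G (punchIn y u) (punchIn y v)
  ; irrefl = λ v → irrefl G (punchIn y v)
  }

data PunchView (y : Fin (suc n)) : Fin (suc n) → Set where
  hole  : PunchView y y
  other : ∀ u → PunchView y (punchIn y u)

punchView : ∀ (y v : Fin (suc n)) → PunchView y v
punchView y v with y ≟ v
... | yes refl = hole
... | no y≢v   = subst (PunchView y) (punchIn-punchOut y≢v) (other (punchOut y≢v))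

Free : Graph (suc n) → Fin (suc n) → Vec (Fin k) n → Fin k → Set
Free G y c i = ∀ u → Adj G y (punchIn y u) → lookup c u ≢ i

adj? : ∀ (G : Graph n) u v → Dec (Adj G u v)
adj? G u v = adj G u v Bool.≟ true

free? : ∀ (G : Graph (suc n)) y (c : Vec (Fin k) n) i → Dec (Free G y c i)
free? G y c i = all? (λ u → adj? G y (punchIn y u) →-dec ¬? (lookup c u ≟ i))

adj-sym : ∀ (G : Graph n) {u v} → Adj G u v → Adj G v u
adj-sym G {u} {v} uv = trans (sym G v u) uv

adj⇒≢ : ∀ (G : Graph n) {u v} → Adj G u v → u ≢ v
adj⇒≢ G {u} uv refl = contradiction (trans (≡-sym uv) (irrefl G u)) (λ ())

proper-insertAt⁻ : ∀ (G : Graph (suc n)) y (c : Vec (Fin k) n) i →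
  ProperColoring G k (lookup (insertAt c y i)) → ProperColoring (delete G y) k (lookup c) × Free G y c i
proper-insertAt⁻ G y c i pr =
  (λ u v uv eq → pr (punchIn y u) (punchIn y v) uv
    (trans (insertAt-punchIn c y i u) (trans eq (≡-sym (insertAt-punchIn c y i v))))) ,
  (λ u yu eq → pr y (punchIn y u) yu (trans (insertAt-lookup c y i) (≡-sym (trans (insertAt-punchIn c y i u) eq))))

proper-insertAt⁺ : ∀ (G : Graph (suc n)) y (c : Vec (Fin k) n) i →
  ProperColoring (delete G y) k (lookup c) → Free G y c i → ProperColoring G k (lookup (insertAt c y i))
proper-insertAt⁺ G y c i pr fr u v uv eq with punchView y u | punchView y v
... | hole    | hole    = adj⇒≢ G uv refl
... | hole    | other b = fr b uv (trans (≡-sym (insertAt-punchIn c y i b)) (trans (≡-sym eq) (insertAt-lookup c y i)))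
... | other a | hole    = fr a (adj-sym G uv) (trans (≡-sym (insertAt-punchIn c y i a)) (trans eq (insertAt-lookup c y i)))
... | other a | other b = pr a b uv (trans (≡-sym (insertAt-punchIn c y i a)) (trans eq (insertAt-punchIn c y i b)))

χ-insertAt : ∀ (G : Graph (suc n)) y (c : Vec (Fin k) n) i →
  χ (proper? G (insertAt c y i)) ≡ χ (proper? (delete G y) c) * χ (free? G y c i)
χ-insertAt G y c i = trans
  (χ-cong (proper? G (insertAt c y i)) (proper? (delete G y) c ×-dec free? G y c i)
    (proper-insertAt⁻ G y c i) (λ (p , f) → proper-insertAt⁺ G y c i p f))
  (χ-×-* (proper? (delete G y) c) (free? G y c i))

chromPoly-delete : ∀ (G : Graph (suc n)) y k →
  chromPoly G k ≡ ∑ (λ c → χ (proper? (delete G y) c) * ∑ (λ i → χ (free? G y c i)) (allFin k)) (allVecs n k)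
chromPoly-delete {n} G y k = begin
  chromPoly G k                                                              ≡⟨ chromPoly-∑ G k ⟩
  ∑ (λ c → χ (proper? G c)) (allVecs (suc n) k)                              ≡⟨ ∑-insertAt (λ c → χ (proper? G c)) y ⟩
  ∑ (λ c → ∑ (λ i → χ (proper? G (insertAt c y i))) (allFin k)) (allVecs n k) ≡⟨ ∑-cong (allVecs n k) (λ c → trans (∑-cong (allFin k) (χ-insertAt G y c)) (∑-*ˡ (χ (proper? (delete G y) c)) (λ i → χ (free? G y c i)) (allFin k))) ⟩
  ∑ (λ c → χ (proper? (delete G y) c) * ∑ (λ i → χ (free? G y c i)) (allFin k)) (allVecs n k) ∎
  where open ≡-Reasoning

count-avoid-one : ∀ {P : Fin (suc k) → Set} (P? : ∀ i → Dec (P i)) a → ¬ P a →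
  ∑ (λ i → χ (P? i)) (allFin (suc k)) ≤ k
count-avoid-one {k} P? a ¬Pa = begin
  ∑ (λ i → χ (P? i)) (allFin (suc k))                  ≡⟨ ∑-remove (λ i → χ (P? i)) a ⟩
  χ (P? a) + ∑ (λ i → χ (P? (punchIn a i))) (allFin k) ≡⟨ cong (_+ ∑ (λ i → χ (P? (punchIn a i))) (allFin k)) (χ-no (P? a) ¬Pa) ⟩
  ∑ (λ i → χ (P? (punchIn a i))) (allFin k)            ≤⟨ ∑-mono (allFin k) (λ i → χ≤1 (P? (punchIn a i))) ⟩
  ∑ (λ _ → 1) (allFin k)                               ≡⟨ trans (∑-const 1 (allFin k)) (trans (*-identityʳ _) (length-allFin k)) ⟩
  k                                                    ∎
  where open ≤-Reasoning

count-avoid-two : ∀ {P : Fin (suc k) → Set} (P? : ∀ i → Dec (P i)) {a b} → a ≢ b → ¬ P a → ¬ P b →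
  ∑ (λ i → χ (P? i)) (allFin (suc k)) < k
count-avoid-two {zero} P? {zero} {zero} a≢b ¬Pa ¬Pb = contradiction refl a≢b
count-avoid-two {suc k} {P} P? {a} {b} a≢b ¬Pa ¬Pb = s≤s (begin
  ∑ (λ i → χ (P? i)) (allFin (2 + k))                        ≡⟨ ∑-remove (λ i → χ (P? i)) a ⟩
  χ (P? a) + ∑ (λ i → χ (P? (punchIn a i))) (allFin (suc k)) ≡⟨ cong (_+ ∑ (λ i → χ (P? (punchIn a i))) (allFin (suc k))) (χ-no (P? a) ¬Pa) ⟩
  ∑ (λ i → χ (P? (punchIn a i))) (allFin (suc k))            ≤⟨ count-avoid-one (λ i → P? (punchIn a i)) (punchOut a≢b) (subst (¬_ ∘ P) (≡-sym (punchIn-punchOut a≢b)) ¬Pb) ⟩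
  k                                                          ∎)
  where open ≤-Reasoning

-- Reachability, quotients and the identification of two vertices

reach-trans : ∀ {G : Graph n} {u v w} → Reach G u v → Reach G v w → Reach G u w
reach-trans here       q = q
reach-trans (step e p) q = step e (reach-trans p q)

reach-sym : ∀ {G : Graph n} {u v} → Reach G u v → Reach G v u
reach-sym here               = here
reach-sym {G = G} (step e p) = reach-trans (reach-sym p) (step (adj-sym G e) here)

reach-map : ∀ {m} {G : Graph n} {H : Graph m} (f : Fin n → Fin m) →
  (∀ {u v} → Adj G u v → Adj H (f u) (f v)) → ∀ {u v} → Reach G u v → Reach H (f u) (f v)
reach-map f h here       = here
reach-map f h (step e p) = step (h e) (reach-map f h p)

-- `q-adj` makes the fibres of `q` independent sets, so that merging each fibre creates no loop.
module Quotient {n m} (G : Graph n) (q : Fin n → Fin m) (q-adj : ∀ {u v} → Adj G u v → q u ≢ q v) where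

  Joined : Fin m → Fin m → Set
  Joined a b = ∃ λ u → ∃ λ v → q u ≡ a × q v ≡ b × Adj G u v

  joined? : ∀ a b → Dec (Joined a b)
  joined? a b = any? λ u → any? λ v → (q u ≟ a) ×-dec ((q v ≟ b) ×-dec adj? G u v)

  joined-sym : ∀ {a b} → Joined a b → Joined b a
  joined-sym (u , v , qu , qv , uv) = v , u , qv , qu , adj-sym G uv

  quotient : Graph m
  quotient = record
    { adj    = λ a b → does (joined? a b)
    ; sym    = λ a b → does-⇔ (mk⇔ joined-sym joined-sym) (joined? a b) (joined? b a)
    ; irrefl = λ a → dec-false (joined? a a) λ (u , v , qu , qv , uv) → q-adj uv (trans qu (≡-sym qv))
    }

  adj-quotient⁺ : ∀ {u v} → Adj G u v → Adj quotient (q u) (q v)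
  adj-quotient⁺ {u} {v} uv = dec-true (joined? (q u) (q v)) (u , v , refl , refl , uv)

  adj-quotient⁻ : ∀ {a b} → Adj quotient a b → Joined a b
  adj-quotient⁻ {a} {b} ab with yes j ← joined? a b = j

  quotient-connected : (∀ a → ∃ λ u → q u ≡ a) → Connected G → Connected quotient
  quotient-connected surj con a b with surj a | surj b
  ... | u , refl | v , refl = reach-map q adj-quotient⁺ (con u v)

  quotient-uncolorable : ¬ Colorable G k → ¬ Colorable quotient k
  quotient-uncolorable ¬col (c , pr) = ¬col (c ∘ q , λ u v uv → pr (q u) (q v) (adj-quotient⁺ uv))

  quotient-proper : ∀ {c : Fin n → Fin k} {c′ : Fin m → Fin k} → (∀ u → c u ≡ c′ (q u)) →
    ProperColoring G k c → ProperColoring quotient k c′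
  quotient-proper eq pr a b ab with adj-quotient⁻ ab
  ... | u , v , refl , refl , uv = λ e → pr u v uv (trans (eq u) (trans e (≡-sym (eq v))))

redirect : Fin (suc n) → Fin n → Fin (suc n) → Fin n
redirect y x u with y ≟ u
... | yes _  = x
... | no y≢u = punchOut y≢u

redirect-hole : ∀ (y : Fin (suc n)) x → redirect y x y ≡ x
redirect-hole y x with y ≟ y
... | yes _ = refl
... | no ¬e = contradiction refl ¬e

redirect-punchIn : ∀ (y : Fin (suc n)) x u → redirect y x (punchIn y u) ≡ u
redirect-punchIn y x u with y ≟ punchIn y u
... | yes e = contradiction (≡-sym e) (punchInᵢ≢i y u)
... | no ¬e = punchIn-injective y _ _ (punchIn-punchOut ¬e)

lookup-redirect : ∀ (c : Vec (Fin k) n) y x {i} → i ≡ lookup c x →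
  ∀ u → lookup (insertAt c y i) u ≡ lookup c (redirect y x u)
lookup-redirect c y x {i} eq u with punchView y u
... | hole    = trans (insertAt-lookup c y i) (trans eq (cong (lookup c) (≡-sym (redirect-hole y x))))
... | other a = trans (insertAt-punchIn c y i a) (cong (lookup c) (≡-sym (redirect-punchIn y x a)))

redirect-adj : ∀ (G : Graph (suc n)) y x → ¬ Adj G y (punchIn y x) →
  ∀ {u v} → Adj G u v → redirect y x u ≢ redirect y x v
redirect-adj G y x ¬yx {u} {v} uv with punchView y u | punchView y v
... | hole | hole = λ _ → adj⇒≢ G uv refl
... | hole | other b rewrite redirect-hole y x | redirect-punchIn y x b = λ { refl → ¬yx uv }
... | other a | hole rewrite redirect-hole y x | redirect-punchIn y x a = λ { refl → ¬yx (adj-sym G uv) }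
... | other a | other b rewrite redirect-punchIn y x a | redirect-punchIn y x b = λ { refl → adj⇒≢ G uv refl }

-- The colour at `y` is forced to be the one at `x`, so forgetting it is injective.
count-insertAt-≤ : ∀ {P : Vec (Fin k) (suc n) → Set} {Q : Vec (Fin k) n → Set}
  (P? : ∀ c → Dec (P c)) (Q? : ∀ c → Dec (Q c)) y x →
  (∀ c i → P (insertAt c y i) → i ≡ lookup c x × Q c) →
  ∑ (λ c → χ (P? c)) (allVecs (suc n) k) ≤ ∑ (λ c → χ (Q? c)) (allVecs n k)
count-insertAt-≤ {k} {n} P? Q? y x h = begin
  ∑ (λ c → χ (P? c)) (allVecs (suc n) k)
    ≡⟨ ∑-insertAt (λ c → χ (P? c)) y ⟩
  ∑ (λ c → ∑ (λ i → χ (P? (insertAt c y i))) (allFin k)) (allVecs n k)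
    ≤⟨ ∑-mono (allVecs n k) (λ c → ∑-mono (allFin k) (λ i → term c i)) ⟩
  ∑ (λ c → ∑ (λ i → χ (Q? c) * χ (i ≟ lookup c x)) (allFin k)) (allVecs n k)
    ≡⟨ ∑-cong (allVecs n k) (λ c → trans (∑-*ˡ (χ (Q? c)) (λ i → χ (i ≟ lookup c x)) (allFin k))
         (trans (cong (χ (Q? c) *_) (∑χ≟ (lookup c x))) (*-identityʳ _))) ⟩
  ∑ (λ c → χ (Q? c)) (allVecs n k) ∎
  where
  open ≤-Reasoning
  term : ∀ c i → χ (P? (insertAt c y i)) ≤ χ (Q? c) * χ (i ≟ lookup c x)
  term c i = ≤-trans (χ-mono (P? (insertAt c y i)) (Q? c ×-dec (i ≟ lookup c x)) (λ p → proj₂ (h c i p) , proj₁ (h c i p)))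
                     (≤-reflexive (χ-×-* (Q? c) (i ≟ lookup c x)))

module Identify {n} (G : Graph (suc n)) (y : Fin (suc n)) (x : Fin n) (¬yx : ¬ Adj G y (punchIn y x)) where

  open Quotient G (redirect y x) (λ {u} {v} → redirect-adj G y x ¬yx {u} {v}) public

  identified-connected : Connected G → Connected quotient
  identified-connected = quotient-connected (λ a → punchIn y a , redirect-punchIn y x a)

  identified-proper : ∀ (c : Vec (Fin k) n) i → ProperColoring G k (lookup (insertAt c y i)) →
    lookup (insertAt c y i) (punchIn y x) ≡ lookup (insertAt c y i) y →
    i ≡ lookup c x × ProperColoring quotient k (lookup c)
  identified-proper c i pr eq = i≡ , quotient-proper (lookup-redirect c y x i≡) pr
    where
    i≡ = trans (≡-sym (insertAt-lookup c y i)) (trans (≡-sym eq) (insertAt-punchIn c y i x))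

-- Colourings that agree on two or three given vertices

Equal₂ : Graph n → (x y : Fin n) → Vec (Fin k) n → Set
Equal₂ {k = k} G x y c = ProperColoring G k (lookup c) × lookup c x ≡ lookup c y

equal₂? : ∀ (G : Graph n) x y (c : Vec (Fin k) n) → Dec (Equal₂ G x y c)
equal₂? G x y c = proper? G c ×-dec (lookup c x ≟ lookup c y)

Equal₃ : Graph n → (x y z : Fin n) → Vec (Fin k) n → Set
Equal₃ {k = k} G x y z c = Equal₂ G x y c × lookup c x ≡ lookup c z

equal₃? : ∀ (G : Graph n) x y z (c : Vec (Fin k) n) → Dec (Equal₃ G x y z c)
equal₃? G x y z c = equal₂? G x y c ×-dec (lookup c x ≟ lookup c z)

-- Such colourings are colourings of the graph with `x` and `y` identified, which stays connected
-- and not m-colourable; one vertex fewer lowers the bound by a factor m. Adjacent vertices never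
-- agree.
count-equal₂-≤ : ∀ {m} → Bounded m n → (G : Graph (suc n)) → Connected G → ¬ Colorable G m →
  ∀ {x y} → x ≢ y → m * ∑ (λ c → χ (equal₂? G x y c)) (allVecs (suc n) (suc m)) ≤ bound m (suc n)
count-equal₂-≤ {n} {m} bdd G con ¬col {x} {y} x≢y with punchView y x
... | hole = contradiction refl x≢y
... | other a with adj? G y (punchIn y a)
...   | yes e = ≤-trans (≤-reflexive (trans (cong (m *_) (trans (∑-cong (allVecs (suc n) (suc m))
                  (λ c → χ-no (equal₂? G (punchIn y a) y c) (λ (pr , eq) → pr y (punchIn y a) e (≡-sym eq))))
                  (∑-zero (allVecs (suc n) (suc m))))) (*-zeroʳ m))) z≤n
...   | no ¬e = begin
  m * ∑ (λ c → χ (equal₂? G (punchIn y a) y c)) (allVecs (suc n) (suc m))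
    ≤⟨ *-monoʳ-≤ m (count-insertAt-≤ (equal₂? G (punchIn y a) y) (proper? quotient) y a (λ c i (pr , eq) → identified-proper c i pr eq)) ⟩
  m * ∑ (λ c → χ (proper? quotient c)) (allVecs n (suc m))
    ≡⟨ cong (m *_) (≡-sym (chromPoly-∑ quotient (suc m))) ⟩
  m * chromPoly quotient (suc m)
    ≤⟨ *-monoʳ-≤ m (bdd quotient (identified-connected con) (quotient-uncolorable ¬col)) ⟩
  m * bound m n
    ≡⟨ ≡-sym (bound-suc (uncolorable⇒< quotient (quotient-uncolorable ¬col))) ⟩
  bound m (suc n) ∎
  where
  open ≤-Reasoning
  open Identify G y a ¬e

-- Merging `y` into `x` leaves a quotient to which `count-equal₂-≤` applies, and each of the two
-- identifications saves a factor m. The merger may make `a` adjacent to `b`, which is why the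
-- statement for two vertices does not assume nonadjacency.
count-equal₃-≤ : ∀ {m} → Bounded m n → (G : Graph (2 + n)) → Connected G → ¬ Colorable G m →
  ∀ {x y z} → x ≢ y → x ≢ z → y ≢ z →
  m * (m * ∑ (λ c → χ (equal₃? G x y z c)) (allVecs (2 + n) (suc m))) ≤ bound m (2 + n)
count-equal₃-≤ {n} {m} bdd G con ¬col {x} {y} {z} x≢y x≢z y≢z with punchView y x | punchView y z
... | hole | _ = contradiction refl x≢y
... | _ | hole = contradiction refl y≢z
... | other a | other b with adj? G y (punchIn y a)
...   | yes e = ≤-trans (≤-reflexive (trans (cong (λ t → m * (m * t)) (trans (∑-cong (allVecs (2 + n) (suc m))
                  (λ c → χ-no (equal₃? G (punchIn y a) y (punchIn y b) c) (λ ((pr , eq) , _) → pr y (punchIn y a) e (≡-sym eq))))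
                  (∑-zero (allVecs (2 + n) (suc m))))) (trans (cong (m *_) (*-zeroʳ m)) (*-zeroʳ m)))) z≤n
...   | no ¬e = begin
  m * (m * ∑ (λ c → χ (equal₃? G (punchIn y a) y (punchIn y b) c)) (allVecs (2 + n) (suc m)))
    ≤⟨ *-monoʳ-≤ m (*-monoʳ-≤ m (count-insertAt-≤ {k = suc m} (equal₃? G (punchIn y a) y (punchIn y b)) (equal₂? quotient a b) y a
         (λ c i ((pr , eq) , eq′) → let (i≡ , pr′) = identified-proper c i pr eq in
           i≡ , pr′ , trans (≡-sym (insertAt-punchIn c y i a)) (trans eq′ (insertAt-punchIn c y i b))))) ⟩
  m * (m * ∑ (λ c → χ (equal₂? quotient a b c)) (allVecs (suc n) (suc m)))
    ≤⟨ *-monoʳ-≤ m (count-equal₂-≤ bdd quotient (identified-connected con) (quotient-uncolorable ¬col) {a} {b} (λ { refl → x≢z refl })) ⟩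
  m * bound m (suc n)
    ≡⟨ ≡-sym (bound-suc (uncolorable⇒< quotient (quotient-uncolorable ¬col))) ⟩
  bound m (2 + n) ∎
  where
  open ≤-Reasoning
  open Identify G y a ¬e

-- The 2-core of a graph with a leaf

𝟙 : Bool → ℕ
𝟙 b = if b then 1 else 0

sum-map : ∀ (f : A → ℕ) xs → sum (map f xs) ≡ ∑ f xs
sum-map f []       = refl
sum-map f (x ∷ xs) = cong (f x +_) (sum-map f xs)

∣∣-∑ : ∀ (S : Subset n) → ∣ S ∣ ≡ ∑ (λ v → 𝟙 (lookup S v)) (allFin n)
∣∣-∑ []                = refl
∣∣-∑ (false ∷ S) = trans (∣∣-∑ S) (≡-sym (∑-allFin (λ v → 𝟙 (lookup (false ∷ S) v))))
∣∣-∑ (true ∷ S)  = trans (cong suc (∣∣-∑ S)) (≡-sym (∑-allFin (λ v → 𝟙 (lookup (true ∷ S) v))))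

degIn-∑ : ∀ (G : Graph n) S v → degIn G S v ≡ ∑ (λ u → 𝟙 (lookup S u ∧ adj G v u)) (allFin n)
degIn-∑ {n} G S v = sum-map (λ u → 𝟙 (lookup S u ∧ adj G v u)) (allFin n)

∧-true⁻ : ∀ {a b} → a ∧ b ≡ true → a ≡ true × b ≡ true
∧-true⁻ {true} {true} _ = refl , refl

∧-true⁺ : ∀ {a b} → a ≡ true → b ≡ true → a ∧ b ≡ true
∧-true⁺ refl refl = refl

𝟙-mono : ∀ {a b} → (a ≡ true → b ≡ true) → 𝟙 a ≤ 𝟙 b
𝟙-mono {false}        h = z≤n
𝟙-mono {true} {true}  h = ≤-refl
𝟙-mono {true} {false} h = contradiction (h refl) (λ ())

coreStep⁻ : ∀ (G : Graph n) S {v} → lookup (coreStep G S) v ≡ true → lookup S v ≡ true × 2 ≤ degIn G S v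
coreStep⁻ G S {v} eq with ∧-true⁻ (trans (≡-sym (lookup∘tabulate (λ v → lookup S v ∧ (2 ≤ᵇ degIn G S v)) v)) eq)
... | s , d = s , ≤ᵇ⇒≤ 2 _ (Equivalence.from T-≡ d)

coreStep⁺ : ∀ (G : Graph n) S {v} → lookup S v ≡ true → 2 ≤ degIn G S v → lookup (coreStep G S) v ≡ true
coreStep⁺ G S {v} s d = trans (lookup∘tabulate (λ v → lookup S v ∧ (2 ≤ᵇ degIn G S v)) v)
  (∧-true⁺ s (Equivalence.to T-≡ (≤⇒≤ᵇ d)))

≢true⇒false : ∀ {b} → b ≢ true → b ≡ false
≢true⇒false {false} _ = refl
≢true⇒false {true}  h = contradiction refl h

module LeafCore {n} (G : Graph (suc n)) (w : Fin (suc n)) where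
  private
    H = delete G w

  -- The invariant that bounds the 2-core of `G` from above while both graphs are peeled in
  -- parallel.
  Shadow : Subset (suc n) → Subset n → Set
  Shadow S T = lookup S w ≡ false × (∀ u → lookup S (punchIn w u) ≡ true → lookup T u ≡ true)

  shadow-degIn : ∀ {S T} → Shadow S T → ∀ u → degIn G S (punchIn w u) ≤ degIn H T u
  shadow-degIn {S} {T} (sw , st) u = begin
    degIn G S (punchIn w u)                                   ≡⟨ degIn-∑ G S (punchIn w u) ⟩
    ∑ f (allFin (suc n))                                      ≡⟨ ∑-remove f w ⟩
    f w + ∑ (f ∘ punchIn w) (allFin n)                        ≡⟨ cong (λ b → 𝟙 (b ∧ adj G (punchIn w u) w) + ∑ (f ∘ punchIn w) (allFin n)) sw ⟩
    ∑ (f ∘ punchIn w) (allFin n)                              ≤⟨ ∑-mono (allFin n) (λ v → 𝟙-mono (λ e → ∧-true⁺ (st v (proj₁ (∧-true⁻ e))) (proj₂ (∧-true⁻ {lookup S (punchIn w v)} e)))) ⟩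
    ∑ (λ v → 𝟙 (lookup T v ∧ adj H u v)) (allFin n)           ≡⟨ ≡-sym (degIn-∑ H T u) ⟩
    degIn H T u                                               ∎
    where
    open ≤-Reasoning
    f : Fin (suc n) → ℕ
    f v = 𝟙 (lookup S v ∧ adj G (punchIn w u) v)

  shadow-coreStep : ∀ {S T} → Shadow S T → Shadow (coreStep G S) (coreStep H T)
  shadow-coreStep {S} {T} sh@(sw , st) =
    ≢true⇒false (λ e → contradiction (trans (≡-sym sw) (proj₁ (coreStep⁻ G S e))) (λ ())) ,
    λ u e → let (s , d) = coreStep⁻ G S e in coreStep⁺ H T (st u s) (≤-trans d (shadow-degIn {S} {T} sh u))

  shadow-iterate : ∀ i {S T} → Shadow S T → Shadow (iterateN i (coreStep G) S) (iterateN i (coreStep H) T)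
  shadow-iterate zero    sh = sh
  shadow-iterate (suc i) {S} {T} sh = shadow-iterate i (shadow-coreStep {S} {T} sh)

  -- The first of the `suc n` rounds for `G` removes the leaf `w`; the remaining `n` rounds run
  -- alongside the `n` rounds for `H`.
  leaf-shadow : ∀ x → (∀ v → Adj G w v → v ≡ x) → Shadow (twoCore G) (twoCore H)
  leaf-shadow x leaf = shadow-iterate n
    ( ≢true⇒false (λ e → ≤⇒≯ deg≤1 (proj₂ (coreStep⁻ G full e)))
    , λ u _ → lookup∘tabulate (λ _ → true) u )
    where
    open ≤-Reasoning
    full : Subset (suc n)
    full = tabulate (λ _ → true)
    deg≤1 : degIn G full w ≤ 1
    deg≤1 = begin
      degIn G full w                                                 ≡⟨ degIn-∑ G full w ⟩
      ∑ (λ v → 𝟙 (lookup full v ∧ adj G w v)) (allFin (suc n))       ≤⟨ ∑-mono (allFin (suc n)) term ⟩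
      ∑ (λ v → χ (v ≟ x)) (allFin (suc n))                           ≡⟨ ∑χ≟ x ⟩
      1                                                              ∎
      where
      term : ∀ v → 𝟙 (lookup full v ∧ adj G w v) ≤ χ (v ≟ x)
      term v with lookup full v ∧ adj G w v in eq
      ... | false = z≤n
      ... | true  = ≤-reflexive (≡-sym (χ-yes (v ≟ x) (leaf v (proj₂ (∧-true⁻ {lookup full v} eq)))))

  module _ (K : Subset n) (K-deg : ∀ u → lookup K u ≡ true → 2 ≤ degIn H K u) where

    Contains : Subset (suc n) → Set
    Contains S = ∀ u → lookup K u ≡ true → lookup S (punchIn w u) ≡ true

    -- A set of minimum inner degree at least 2 is never peeled. The degrees are a hypothesis on
    -- `K`, to be supplied by the clique, so it need not be shown that the iteration has stabilised.
    contains-coreStep : ∀ {S} → Contains S → Contains (coreStep G S)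
    contains-coreStep {S} K⊆S u u∈ = coreStep⁺ G S (K⊆S u u∈) (≤-trans (K-deg u u∈) (begin
      degIn H K u                                          ≡⟨ degIn-∑ H K u ⟩
      ∑ (λ v → 𝟙 (lookup K v ∧ adj H u v)) (allFin n)      ≤⟨ ∑-mono (allFin n) (λ v → 𝟙-mono (λ e → ∧-true⁺ (K⊆S v (proj₁ (∧-true⁻ e))) (proj₂ (∧-true⁻ {lookup K v} e)))) ⟩
      ∑ (f ∘ punchIn w) (allFin n)                         ≤⟨ m≤n+m _ (f w) ⟩
      f w + ∑ (f ∘ punchIn w) (allFin n)                   ≡⟨ ≡-sym (∑-remove f w) ⟩
      ∑ f (allFin (suc n))                                 ≡⟨ ≡-sym (degIn-∑ G S (punchIn w u)) ⟩
      degIn G S (punchIn w u)                              ∎))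
      where
      open ≤-Reasoning
      f : Fin (suc n) → ℕ
      f v = 𝟙 (lookup S v ∧ adj G (punchIn w u) v)

    contains-iterate : ∀ i {S} → Contains S → Contains (iterateN i (coreStep G) S)
    contains-iterate zero    K⊆S = K⊆S
    contains-iterate (suc i) {S} K⊆S = contains-iterate i (contains-coreStep {S} K⊆S)

  clique-degIn : 3 ≤ k → TwoCoreIsClique H k → ∀ u → lookup (twoCore H) u ≡ true → 2 ≤ degIn H (twoCore H) u
  clique-degIn {k} 3≤k (size , clique) u u∈ = ≤-pred (≤-trans 3≤k (begin
    k                                                            ≡⟨ ≡-sym size ⟩
    ∣ K ∣                                                        ≡⟨ ∣∣-∑ K ⟩
    ∑ (λ v → 𝟙 (lookup K v)) (allFin n)                          ≤⟨ ∑-mono (allFin n) term ⟩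
    ∑ (λ v → χ (v ≟ u) + 𝟙 (lookup K v ∧ adj H u v)) (allFin n)  ≡⟨ ∑-distrib (λ v → χ (v ≟ u)) (λ v → 𝟙 (lookup K v ∧ adj H u v)) (allFin n) ⟩
    ∑ (λ v → χ (v ≟ u)) (allFin n) + ∑ (λ v → 𝟙 (lookup K v ∧ adj H u v)) (allFin n) ≡⟨ cong₂ _+_ (∑χ≟ u) (≡-sym (degIn-∑ H K u)) ⟩
    suc (degIn H K u)                                            ∎))
    where
    open ≤-Reasoning
    K = twoCore H
    term : ∀ v → 𝟙 (lookup K v) ≤ χ (v ≟ u) + 𝟙 (lookup K v ∧ adj H u v)
    term v with lookup K v in v∈
    ... | false = z≤n
    ... | true with v ≟ u
    ...   | yes _   = s≤s z≤n
    ...   | no v≢u  = ≤-reflexive (≡-sym (cong 𝟙 (clique u v u∈ v∈ (λ e → v≢u (≡-sym e)))))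

  -- `leaf-shadow` gives one inclusion between the two cores and `contains-iterate`, with the clique
  -- as `K`, the other. This excludes a leaf in the equality case: if the core of `H` were a clique,
  -- so would be that of `G`.
  leaf-twoCore : 3 ≤ k → ∀ x → (∀ v → Adj G w v → v ≡ x) → TwoCoreIsClique H k → TwoCoreIsClique G k
  leaf-twoCore {k} 3≤k x leaf cl@(size , clique) = trans size′ size , clique′
    where
    sh = leaf-shadow x leaf
    core-punchIn : ∀ u → lookup (twoCore G) (punchIn w u) ≡ lookup (twoCore H) u
    core-punchIn u with lookup (twoCore H) u in eq
    ... | true  = contains-iterate (twoCore H) (clique-degIn 3≤k cl) (suc n) {tabulate (λ _ → true)} (λ v _ → lookup∘tabulate (λ _ → true) (punchIn w v)) u eq
    ... | false = ≢true⇒false (λ e → contradiction (trans (≡-sym eq) (proj₂ sh u e)) (λ ()))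
    size′ : ∣ twoCore G ∣ ≡ ∣ twoCore H ∣
    size′ = begin
      ∣ twoCore G ∣                                                   ≡⟨ ∣∣-∑ (twoCore G) ⟩
      ∑ (λ v → 𝟙 (lookup (twoCore G) v)) (allFin (suc n))             ≡⟨ ∑-remove (λ v → 𝟙 (lookup (twoCore G) v)) w ⟩
      𝟙 (lookup (twoCore G) w) + ∑ (λ v → 𝟙 (lookup (twoCore G) (punchIn w v))) (allFin n) ≡⟨ cong₂ _+_ (cong 𝟙 (proj₁ sh)) (∑-cong (allFin n) (λ v → cong 𝟙 (core-punchIn v))) ⟩
      ∑ (λ v → 𝟙 (lookup (twoCore H) v)) (allFin n)                   ≡⟨ ≡-sym (∣∣-∑ (twoCore H)) ⟩
      ∣ twoCore H ∣                                                   ∎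
      where open ≡-Reasoning
    clique′ : ∀ u v → lookup (twoCore G) u ≡ true → lookup (twoCore G) v ≡ true → u ≢ v → Adj G u v
    clique′ u v u∈ v∈ u≢v with punchView w u | punchView w v
    ... | hole | _ = contradiction (trans (≡-sym (proj₁ sh)) u∈) (λ ())
    ... | other a | hole = contradiction (trans (≡-sym (proj₁ sh)) v∈) (λ ())
    ... | other a | other b = clique a b (trans (≡-sym (core-punchIn a)) u∈) (trans (≡-sym (core-punchIn b)) v∈)
                                (λ { refl → u≢v refl })

-- Minimal counterexamples

Minimal : ℕ → ℕ → Set
Minimal k n = ∀ j (H : Graph j) → Counterexample k H → n ≤ j

minimal-bounded : ∀ {m n} → Minimal (suc m) n → ∀ {j} → j < n → Bounded m j
minimal-bounded {m} min {j} j<n = bounded-of-chromatic λ H con chr → ≮⇒≥ λ lt →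
  <⇒≱ j<n (min j H (con , chr , inj₁ lt))

counterexample-≥ : ∀ {m} {G : Graph n} → Counterexample (suc m) G → bound m n ≤ chromPoly G (suc m)
counterexample-≥ (_ , _ , inj₁ lt)       = <⇒≤ lt
counterexample-≥ (_ , _ , inj₂ (eq , _)) = ≤-reflexive (≡-sym eq)

neighbour : ∀ (G : Graph n) → Connected G → ∀ {u v} → u ≢ v → ∃ λ x → Adj G u x
neighbour G con {u} {v} u≢v with con u v
... | here            = contradiction refl u≢v
... | step {v = x} e _ = x , e

bound>0 : ∀ m n .{{_ : NonZero m}} → 0 < bound m n
bound>0 m n = *-mono-≤ (1≤n! (suc m)) (m^n>0 m (n ∸ suc m))

-- Suppose G - w is not m-colourable. Deleting w loses at least a factor m, so minimality forces equality
-- throughout. If w has two neighbours x, y, then every colouring of G - w gives them the same colour,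
-- which is too many after identifying x with y; if w is a leaf, then G - w is a smaller counterexample.
noncut-colorable : ∀ {m n} → 2 ≤ m → (G : Graph (suc n)) → Counterexample (suc m) G → Minimal (suc m) (suc n) →
  ∀ w → Connected (delete G w) → Colorable (delete G w) m
noncut-colorable {m} {zero} 2≤m G ce min w Hcon = (λ ()) , λ ()
noncut-colorable {m} {suc n} 2≤m G ce@(con , (col , _) , _) min w Hcon with colorable? (delete G w) m
... | yes c = c
... | no ¬col = ⊥-elim contra
  where
  open ≤-Reasoning
  H = delete G w
  instance
    m≢0 : NonZero m
    m≢0 = >-nonZero (≤-trans (s≤s z≤n) 2≤m)
  Cs = allVecs (suc n) (suc m)
  F : Vec (Fin (suc m)) (suc n) → ℕ
  F c = ∑ (λ i → χ (free? G w c i)) (allFin (suc m))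
  PG = chromPoly G (suc m)
  PH = chromPoly H (suc m)
  bG : bound m (2 + n) ≡ m * bound m (suc n)
  bG = bound-suc (uncolorable⇒< H ¬col)
  PH≤ : PH ≤ bound m (suc n)
  PH≤ = minimal-bounded min ≤-refl H Hcon ¬col
  m*bound≤PG : m * bound m (suc n) ≤ PG
  m*bound≤PG = subst (_≤ PG) bG (counterexample-≥ {G = G} ce)
  m*PH : ∑ (λ c → χ (proper? H c) * m) Cs ≡ m * PH
  m*PH = trans (∑-cong Cs (λ c → *-comm (χ (proper? H c)) m))
    (trans (∑-*ˡ m (λ c → χ (proper? H c)) Cs) (cong (m *_) (≡-sym (chromPoly-∑ H (suc m)))))
  contra : ⊥
  contra with neighbour G con {w} {punchIn w zero} (λ e → punchInᵢ≢i w zero (≡-sym e))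
  ... | x̂ , wx with punchView w x̂
  ...   | hole = adj⇒≢ G wx refl
  ...   | other x = cases (any? (λ y → adj? G w (punchIn w y) ×-dec ¬? (y ≟ x)))
    where
    F≤m : ∀ c → F c ≤ m
    F≤m c = count-avoid-one (free? G w c) (lookup c x) (λ fr → fr x wx refl)
    PG≤ : PG ≤ m * PH
    PG≤ = begin
      PG                                      ≡⟨ chromPoly-delete G w (suc m) ⟩
      ∑ (λ c → χ (proper? H c) * F c) Cs      ≤⟨ ∑-mono Cs (λ c → *-monoʳ-≤ (χ (proper? H c)) (F≤m c)) ⟩
      ∑ (λ c → χ (proper? H c) * m) Cs        ≡⟨ m*PH ⟩
      m * PH                                  ∎
    PH≡ : PH ≡ bound m (suc n)
    PH≡ = ≤-antisym PH≤ (*-cancelˡ-≤ m (≤-trans m*bound≤PG PG≤))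
    cases : Dec (∃ λ y → Adj G w (punchIn w y) × y ≢ x) → ⊥
    cases (yes (y , wy , y≢x)) = <⇒≱ (m<m*n E m {{>-nonZero E>0}} 2≤m) (begin
      E * m              ≡⟨ *-comm E m ⟩
      m * E              ≤⟨ count-equal₂-≤ (minimal-bounded min (m≤n⇒m≤1+n ≤-refl)) H Hcon ¬col {x} {y} (λ e → y≢x (≡-sym e)) ⟩
      bound m (suc n)    ≡⟨ ≡-sym E≡ ⟩
      E                  ∎)
      where
      E = ∑ (λ c → χ (equal₂? H x y c)) Cs
      -- `D` counts the colourings of `H` that separate `x` from `y`. Each of them blocks a second
      -- colour at `w`, so `D` is a loss against `m * PH`, and equality throughout makes it vanish.
      D = ∑ (λ c → χ (proper? H c) * χ (¬? (lookup c x ≟ lookup c y))) Cs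
      F+≤m : ∀ c → F c + χ (¬? (lookup c x ≟ lookup c y)) ≤ m
      F+≤m c with lookup c x ≟ lookup c y
      ... | yes _ = ≤-trans (≤-reflexive (+-identityʳ (F c))) (F≤m c)
      ... | no ne = ≤-trans (≤-reflexive (+-comm (F c) 1))
                (count-avoid-two (free? G w c) ne (λ fr → fr x wx refl) (λ fr → fr y wy refl))
      PG+D≤ : PG + D ≤ m * PH
      PG+D≤ = begin
        PG + D
          ≡⟨ cong (_+ D) (chromPoly-delete G w (suc m)) ⟩
        ∑ (λ c → χ (proper? H c) * F c) Cs + D
          ≡⟨ ≡-sym (∑-distrib (λ c → χ (proper? H c) * F c) (λ c → χ (proper? H c) * χ (¬? (lookup c x ≟ lookup c y))) Cs) ⟩
        ∑ (λ c → χ (proper? H c) * F c + χ (proper? H c) * χ (¬? (lookup c x ≟ lookup c y))) Cs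
          ≤⟨ ∑-mono Cs (λ c → ≤-trans (≤-reflexive (≡-sym (*-distribˡ-+ (χ (proper? H c)) (F c) _))) (*-monoʳ-≤ (χ (proper? H c)) (F+≤m c))) ⟩
        ∑ (λ c → χ (proper? H c) * m) Cs
          ≡⟨ m*PH ⟩
        m * PH ∎
      D≡0 : D ≡ 0
      D≡0 = n≤0⇒n≡0 (+-cancelˡ-≤ PG D 0 (begin
        PG + D               ≤⟨ PG+D≤ ⟩
        m * PH               ≤⟨ *-monoʳ-≤ m PH≤ ⟩
        m * bound m (suc n)  ≤⟨ m*bound≤PG ⟩
        PG                   ≡⟨ ≡-sym (+-identityʳ PG) ⟩
        PG + 0               ∎))
      split : ∀ c → χ (proper? H c) ≡ χ (equal₂? H x y c) + χ (proper? H c) * χ (¬? (lookup c x ≟ lookup c y))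
      split c with proper? H c | lookup c x ≟ lookup c y
      ... | yes _ | yes _ = refl
      ... | yes _ | no _  = refl
      ... | no _  | yes _ = refl
      ... | no _  | no _  = refl
      E≡ : E ≡ bound m (suc n)
      E≡ = begin-equality
        E                                ≡⟨ ≡-sym (+-identityʳ E) ⟩
        E + 0                            ≡⟨ cong (E +_) (≡-sym D≡0) ⟩
        E + D                            ≡⟨ ≡-sym (∑-distrib (λ c → χ (equal₂? H x y c)) (λ c → χ (proper? H c) * χ (¬? (lookup c x ≟ lookup c y))) Cs) ⟩
        ∑ (λ c → χ (equal₂? H x y c) + χ (proper? H c) * χ (¬? (lookup c x ≟ lookup c y))) Cs ≡⟨ ∑-cong Cs (λ c → ≡-sym (split c)) ⟩
        ∑ (λ c → χ (proper? H c)) Cs     ≡⟨ ≡-sym (chromPoly-∑ H (suc m)) ⟩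
        PH                               ≡⟨ PH≡ ⟩
        bound m (suc n)                  ∎
      E>0 : 0 < E
      E>0 = subst (0 <_) (≡-sym E≡) (bound>0 m (suc n))
    cases (no ¬other) = <-irrefl refl (min (suc n) H (Hcon , chromatic H Hcol ¬col , inj₂ (PH≡ , ¬clique)))
      where
      Hcol : Colorable H (suc m)
      Hcol = (λ u → proj₁ col (punchIn w u)) , λ u v uv → proj₂ col (punchIn w u) (punchIn w v) uv
      PG≤bound : PG ≤ bound m (2 + n)
      PG≤bound = ≤-trans PG≤ (≤-trans (*-monoʳ-≤ m PH≤) (≤-reflexive (≡-sym bG)))
      leaf : ∀ v → Adj G w v → v ≡ punchIn w x
      leaf v wv with punchView w v
      ... | hole = contradiction refl (adj⇒≢ G wv)
      ... | other y with y ≟ x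
      ...   | yes refl = refl
      ...   | no y≢x   = contradiction (y , wv , y≢x) ¬other
      ¬clique : ¬ TwoCoreIsClique H (suc m)
      ¬clique cl = [ (λ lt → <⇒≱ lt PG≤bound)
                   , (λ (_ , ¬cl) → ¬cl (LeafCore.leaf-twoCore G w (s≤s 2≤m) (punchIn w x) leaf cl)) ]′ (proj₂ (proj₂ ce))

-- Induced subgraphs

Mask : ℕ → Set
Mask n = Fin n → Bool

-- The subgraph induced by T, with the remaining vertices kept as isolated vertices.
induced : Graph n → Mask n → Graph n
induced G T = record
  { adj    = λ u v → (T u ∧ T v) ∧ adj G u v
  ; sym    = λ u v → cong₂ _∧_ (∧-comm (T u) (T v)) (sym G u v)
  ; irrefl = λ v → trans (cong ((T v ∧ T v) ∧_) (irrefl G v)) (∧-zeroʳ (T v ∧ T v))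
  }

adj-induced⁺ : ∀ (G : Graph n) T {u v} → T u ≡ true → T v ≡ true → Adj G u v → Adj (induced G T) u v
adj-induced⁺ G T tu tv uv = ∧-true⁺ (∧-true⁺ tu tv) uv

adj-induced⁻ : ∀ (G : Graph n) T {u v} → Adj (induced G T) u v → T u ≡ true × T v ≡ true × Adj G u v
adj-induced⁻ G T e with ∧-true⁻ e
... | t , uv with ∧-true⁻ t
...   | tu , tv = tu , tv , uv

_⊆ᵐ_ : Mask n → Mask n → Set
T ⊆ᵐ S = ∀ v → T v ≡ true → S v ≡ true

induced-mono : ∀ (G : Graph n) {T S} → T ⊆ᵐ S → ∀ {u v} → Adj (induced G T) u v → Adj (induced G S) u v
induced-mono G {T} {S} T⊆S e with adj-induced⁻ G T e
... | tu , tv , uv = adj-induced⁺ G S (T⊆S _ tu) (T⊆S _ tv) uv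

size : Mask n → ℕ
size {n} T = ∑ (λ v → 𝟙 (T v)) (allFin n)

size-< : ∀ {T S : Mask n} → T ⊆ᵐ S → ∀ w → T w ≡ false → S w ≡ true → size T < size S
size-< {suc n} {T} {S} T⊆S w tw sw = begin
  suc (size T)                                            ≡⟨ cong suc (∑-remove (λ v → 𝟙 (T v)) w) ⟩
  suc (𝟙 (T w) + ∑ (λ v → 𝟙 (T (punchIn w v))) (allFin n)) ≡⟨ cong (λ b → suc (𝟙 b + ∑ (λ v → 𝟙 (T (punchIn w v))) (allFin n))) tw ⟩
  suc (∑ (λ v → 𝟙 (T (punchIn w v))) (allFin n))          ≤⟨ s≤s (∑-mono (allFin n) (λ v → 𝟙-mono (T⊆S (punchIn w v)))) ⟩
  suc (∑ (λ v → 𝟙 (S (punchIn w v))) (allFin n))          ≡⟨ cong (λ b → 𝟙 b + ∑ (λ v → 𝟙 (S (punchIn w v))) (allFin n)) (≡-sym sw) ⟩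
  𝟙 (S w) + ∑ (λ v → 𝟙 (S (punchIn w v))) (allFin n)      ≡⟨ ≡-sym (∑-remove (λ v → 𝟙 (S v)) w) ⟩
  size S                                                  ∎
  where open ≤-Reasoning

size-missing : ∀ (T : Mask n) w → T w ≡ false → size T < n
size-missing {n} T w tw = subst (size T <_) full (size-< {T = T} {λ _ → true} (λ _ _ → refl) w tw refl)
  where
  full : ∑ (λ _ → 1) (allFin n) ≡ n
  full = trans (∑-const 1 (allFin n)) (trans (*-identityʳ _) (length-allFin n))

add : Mask n → Fin n → Mask n
add T w v = T v ∨ does (v ≟ w)

⊆-add : ∀ (T : Mask n) w → T ⊆ᵐ add T w
⊆-add T w v tv rewrite tv = refl

∈-add : ∀ (T : Mask n) w → add T w w ≡ true
∈-add T w rewrite dec-true (w ≟ w) refl = ∨-zeroʳ (T w)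

add⁻ : ∀ (T : Mask n) w v → add T w v ≡ true → T v ≡ true ⊎ v ≡ w
add⁻ T w v e with T v | v ≟ w
... | true  | _       = inj₁ refl
... | false | yes v≡w = inj₂ v≡w

-- T is connected in the sense that each of its vertices is joined to r inside T.
RootedAt : Graph n → Fin n → Mask n → Set
RootedAt G r T = T r ≡ true × (∀ u → T u ≡ true → Reach (induced G T) u r)

rooted-add : ∀ (G : Graph n) {r T t w} → RootedAt G r T → T t ≡ true → Adj G t w → RootedAt G r (add T w)
rooted-add G {r} {T} {t} {w} (tr , reach) tt tw = ⊆-add T w r tr , reach′
  where
  lift : ∀ {u v} → Reach (induced G T) u v → Reach (induced G (add T w)) u v
  lift = reach-map id (λ {u} {v} → induced-mono G (⊆-add T w) {u} {v})
  reach′ : ∀ u → add T w u ≡ true → Reach (induced G (add T w)) u r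
  reach′ u au with add⁻ T w u au
  ... | inj₁ tu   = lift (reach u tu)
  ... | inj₂ refl = step (adj-induced⁺ G (add T w) (∈-add T w) (⊆-add T w t tt) (adj-sym G tw)) (lift (reach t tt))

rooted-single : ∀ (G : Graph n) u → RootedAt G u (λ v → does (v ≟ u))
rooted-single G u = dec-true (u ≟ u) refl , reach
  where
  reach : ∀ v → does (v ≟ u) ≡ true → Reach _ v u
  reach v e with yes refl ← v ≟ u = here

crossing : ∀ (G : Graph n) (T : Mask n) {u v} → Reach G u v → T u ≡ true → T v ≡ false →
  ∃ λ t → ∃ λ w → T t ≡ true × T w ≡ false × Adj G t w
crossing G T here tu tv = contradiction (trans (≡-sym tu) tv) (λ ())
crossing G T (step {u} {v} e p) tu tv with T v in eq
... | true  = crossing G T p eq tv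
... | false = u , v , tu , eq , e

colorable-mono-adj : ∀ {G H : Graph n} → (∀ {u v} → Adj G u v → Adj H u v) → Colorable H k → Colorable G k
colorable-mono-adj h (c , pr) = c , λ u v uv → pr u v (h uv)

reach-delete : ∀ (G : Graph (suc n)) T {w a b u v} → T w ≡ false → Reach (induced G T) a b →
  a ≡ punchIn w u → b ≡ punchIn w v → Reach (delete G w) u v
reach-delete G T {w} {u = u} {v} tw here refl eq = subst (Reach (delete G w) u) (punchIn-injective w u v eq) here
reach-delete G T {w} tw (step {v = a} e p) refl eq with adj-induced⁻ G T e | punchView w a
... | _ , ta , _  | hole    = contradiction (trans (≡-sym tw) ta) (λ ())
... | _ , _  , ua | other x = step ua (reach-delete G T tw p refl eq)

colorable-delete : ∀ (G : Graph (suc n)) T w → T w ≡ false → Fin k → Colorable (delete G w) k → Colorable (induced G T) k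
colorable-delete {n} {k} G T w tw i (c , pr) = c′ , pr′
  where
  c′ : Fin (suc n) → Fin k
  c′ = lookup (insertAt (tabulate c) w i)
  c′-punchIn : ∀ u → c′ (punchIn w u) ≡ c u
  c′-punchIn u = trans (insertAt-punchIn (tabulate c) w i u) (lookup∘tabulate c u)
  pr′ : ProperColoring (induced G T) k c′
  pr′ u v e eq with adj-induced⁻ G T e | punchView w u | punchView w v
  ... | tu , _  , _  | hole    | _       = contradiction (trans (≡-sym tw) tu) (λ ())
  ... | _  , tv , _  | other a | hole    = contradiction (trans (≡-sym tw) tv) (λ ())
  ... | _  , _  , uv | other a | other b = pr a b uv (trans (≡-sym (c′-punchIn a)) (trans eq (c′-punchIn b)))

-- Colouring every proper induced subgraph with `m` colours

module ProperSubsets {m n} (i₀ : Fin m) (G : Graph (suc n)) (con : Connected G)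
  (noncut : ∀ w → Connected (delete G w) → Colorable (delete G w) m) where

  -- Colourability passes down to subsets, so `T` may be enlarged along edges that leave it. When
  -- the next vertex `w` would be the last one, `T` is everything but `w` and connected, hence `w`
  -- is not a cut vertex and `noncut` applies. The fuel counts the vertices still to be added.
  rooted-colorable : ∀ fuel {r T} → RootedAt G r T → ∀ w → T w ≡ false → suc n ≤ fuel + size T →
    Colorable (induced G T) m
  rooted-colorable zero {T = T} _ w tw le = contradiction le (<⇒≱ (size-missing T w tw))
  rooted-colorable (suc fuel) {r} {T} rt@(tr , reach) w₀ tw₀ le with crossing G T (con r w₀) tr tw₀
  ... | t , w , tt , tw , e with any? (λ v → add T w v Bool.≟ false)
  ...   | yes (v , av) = colorable-mono-adj {G = induced G T} {induced G (add T w)} (λ {u} {v} → induced-mono G (⊆-add T w) {u} {v})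
            (rooted-colorable fuel (rooted-add G rt tt e) v av
              (≤-trans le (≤-trans (≤-reflexive (≡-sym (+-suc fuel (size T))))
                (+-monoʳ-≤ fuel (size-< {T = T} (⊆-add T w) w tw (∈-add T w))))))
  ...   | no ¬missing = colorable-delete G T w tw i₀ (noncut w connected)
    where
    all-but-w : ∀ u → T (punchIn w u) ≡ true
    all-but-w u with T (punchIn w u) in eq
    ... | true  = refl
    ... | false = contradiction (punchIn w u , trans (cong (_∨ does (punchIn w u ≟ w)) eq)
                    (dec-false (punchIn w u ≟ w) (punchInᵢ≢i w u))) ¬missing
    connected : Connected (delete G w)
    connected u v = reach-delete G T tw
      (reach-trans (reach (punchIn w u) (all-but-w u)) (reach-sym (reach (punchIn w v) (all-but-w v)))) refl refl

  Closed : Mask (suc n) → Mask (suc n) → Set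
  Closed S T = ∀ t w → T t ≡ true → S w ≡ true → Adj G t w → T w ≡ true

  component : ∀ fuel {u S T} → T ⊆ᵐ S → RootedAt G u T → suc n ≤ fuel + size T →
    ∃ λ T′ → T′ ⊆ᵐ S × RootedAt G u T′ × Closed S T′
  component fuel {u} {S} {T} T⊆S rt le
    with any? (λ t → any? (λ w → (T t Bool.≟ true) ×-dec ((S w Bool.≟ true) ×-dec ((T w Bool.≟ false) ×-dec adj? G t w))))
  ... | no ¬ext = T , T⊆S , rt , closed
    where
    closed : Closed S T
    closed t w tt sw tw with T w in eq
    ... | true  = refl
    ... | false = contradiction (t , w , tt , sw , eq , tw) ¬ext
  component zero {T = T} T⊆S rt le | yes (t , w , _ , _ , tw , _) = contradiction le (<⇒≱ (size-missing T w tw))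
  component (suc fuel) {u} {S} {T} T⊆S rt le | yes (t , w , tt , sw , tw , e) =
    component fuel add⊆S (rooted-add G rt tt e)
      (≤-trans le (≤-trans (≤-reflexive (≡-sym (+-suc fuel (size T))))
        (+-monoʳ-≤ fuel (size-< {T = T} (⊆-add T w) w tw (∈-add T w)))))
    where
    add⊆S : add T w ⊆ᵐ S
    add⊆S v av with add⁻ T w v av
    ... | inj₁ tv   = T⊆S v tv
    ... | inj₂ refl = sw

  -- `T` is the component of some vertex `u` in `S`, and `R` is the rest. As no edge joins them, a
  -- colouring of `T` and one of `R`, obtained by induction on the size, combine. The missing vertex
  -- `w` keeps both sets proper.
  subset-colorable : ∀ fuel S w → S w ≡ false → size S < fuel → Colorable (induced G S) m
  subset-colorable (suc fuel) S w sw (s≤s le) with any? (λ u → S u Bool.≟ true)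
  ... | no empty = (λ _ → i₀) , λ u v e _ → empty (u , proj₁ (adj-induced⁻ G S e))
  ... | yes (u , su) with component (suc n) (λ v e → single⊆S u su v e) (rooted-single G u) (m≤m+n (suc n) _)
    where
    single⊆S : ∀ u → S u ≡ true → (λ v → does (v ≟ u)) ⊆ᵐ S
    single⊆S u su v e with yes refl ← v ≟ u = su
  ...   | T , T⊆S , rt , closed = c , pr
    where
    R : Mask (suc n)
    R v = S v ∧ not (T v)
    R⊆S : R ⊆ᵐ S
    R⊆S v e = proj₁ (∧-true⁻ e)
    Ru : R u ≡ false
    Ru = cong₂ (λ a b → a ∧ not b) su (proj₁ rt)
    Rw : R w ≡ false
    Rw = cong (_∧ not (T w)) sw
    T-col = rooted-colorable (suc n) rt w (≢true⇒false (λ tw → contradiction (trans (≡-sym sw) (T⊆S w tw)) (λ ()))) (m≤m+n (suc n) _)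
    R-col = subset-colorable fuel R w Rw (≤-trans (size-< {T = R} R⊆S u Ru su) le)
    c : Fin (suc n) → Fin m
    c v = if T v then proj₁ T-col v else proj₁ R-col v
    pr : ProperColoring (induced G S) m c
    pr a b e eq with adj-induced⁻ G S e
    ... | sa , sb , ab with T a in ta | T b in tb
    ...   | true  | true  = proj₂ T-col a b (adj-induced⁺ G T ta tb ab) eq
    ...   | true  | false = contradiction (trans (≡-sym (closed a b ta sb ab)) tb) (λ ())
    ...   | false | true  = contradiction (trans (≡-sym (closed b a tb sa (adj-sym G ab))) ta) (λ ())
    ...   | false | false = proj₂ R-col a b (adj-induced⁺ G R (∧-true⁺ sa (cong not ta)) (∧-true⁺ sb (cong not tb)) ab) eq

  -- In an m-colouring of the graph without `v`, a colour absent around `v` could be given to `v`.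
  sees-all-colors : ¬ Colorable G m → ∀ v → ∃ λ (c : Fin (suc n) → Fin m) → ∀ j → ∃ λ u → Adj G v u × c u ≡ j
  sees-all-colors ¬col v = proj₁ col , sees
    where
    S : Mask (suc n)
    S u = not (does (u ≟ v))
    Sv : S v ≡ false
    Sv = cong not (dec-true (v ≟ v) refl)
    S≢ : ∀ {u} → u ≢ v → S u ≡ true
    S≢ {u} u≢v = cong not (dec-false (u ≟ v) u≢v)
    col = subset-colorable (suc (size S)) S v Sv ≤-refl
    sees : ∀ j → ∃ λ u → Adj G v u × proj₁ col u ≡ j
    sees j with any? (λ u → adj? G v u ×-dec (proj₁ col u ≟ j))
    ... | yes p = p
    ... | no ¬p = contradiction (c , pr) ¬col
      where
      c : Fin (suc n) → Fin m
      c u = if does (u ≟ v) then j else proj₁ col u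
      pr : ProperColoring G m c
      pr a b ab eq with a ≟ v | b ≟ v
      ... | yes refl | yes refl = adj⇒≢ G ab refl
      ... | yes refl | no b≢v   = ¬p (b , ab , ≡-sym eq)
      ... | no a≢v   | yes refl = ¬p (a , adj-sym G ab , eq)
      ... | no a≢v   | no b≢v   = proj₂ col a b (adj-induced⁺ G S (S≢ a≢v) (S≢ b≢v) ab) eq

ThreeNeighbours : Graph n → Fin n → Set
ThreeNeighbours {n} G v = ∃ λ (x : Fin n) → ∃ λ y → ∃ λ z →
  (Adj G v x × Adj G v y × Adj G v z) × (x ≢ y × x ≢ z × y ≢ z)

-- Neighbours carrying the colours 0, 1 and 2 are distinct; this is where k ≥ 4 enters, through m ≥
-- 3.
three-neighbours : ∀ {m} → 3 ≤ m → (G : Graph (suc n)) → Counterexample (suc m) G → Minimal (suc m) (suc n) →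
  ∀ v → ThreeNeighbours G v
three-neighbours {n} {m@(suc (suc (suc _)))} 3≤m G ce@(con , (_ , ¬col) , _) min v
  with ProperSubsets.sees-all-colors {m} zero G con (noncut-colorable (≤-trans (s≤s (s≤s z≤n)) 3≤m) G ce min) (¬col m ≤-refl) v
... | c , sees with sees zero | sees (suc zero) | sees (suc (suc zero))
...   | x , vx , cx | y , vy , cy | z , vz , cz = x , y , z , (vx , vy , vz) ,
  ( (λ { refl → contradiction (trans (≡-sym cx) cy) (λ ()) })
  , (λ { refl → contradiction (trans (≡-sym cx) cz) (λ ()) })
  , (λ { refl → contradiction (trans (≡-sym cy) cz) (λ ()) }) )
three-neighbours {m = suc zero} (s≤s ())
three-neighbours {m = suc (suc zero)} (s≤s (s≤s ()))

private
  variable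
    s : ℕ

-- Frozen vertices

-- If no vertex of colour i saw all other colours, the class i could be dissolved.
frozen : ∀ {m} (G : Graph n) → ¬ Colorable G m → ∀ (c : Fin n → Fin (suc m)) → ProperColoring G (suc m) c → ∀ i →
  ∃ λ (t : Fin (suc m) → Fin n) → (∀ j → c (t j) ≡ j) × (∀ j → j ≢ i → Adj G (t i) (t j))
frozen {n} {m} G ¬col c pr i with any? (λ v → (c v ≟ i) ×-dec all? (sees? v))
  where
  sees? : ∀ v j → Dec (j ≢ i → ∃ λ u → Adj G v u × c u ≡ j)
  sees? v j = ¬? (j ≟ i) →-dec any? (λ u → adj? G v u ×-dec (c u ≟ j))
... | yes (v , cv , sees) = t , c∘t , t-adj
  where
  t : Fin (suc m) → Fin n
  t j with j ≟ i
  ... | yes _  = v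
  ... | no j≢i = proj₁ (sees j j≢i)
  c∘t : ∀ j → c (t j) ≡ j
  c∘t j with j ≟ i
  ... | yes refl = cv
  ... | no j≢i   = proj₂ (proj₂ (sees j j≢i))
  t-adj : ∀ j → j ≢ i → Adj G (t i) (t j)
  t-adj j j≢i with i ≟ i | j ≟ i
  ... | no i≢i | _        = contradiction refl i≢i
  ... | yes _  | yes j≡i  = contradiction j≡i j≢i
  ... | yes _  | no j≢i′  = proj₁ (proj₂ (sees j j≢i′))
... | no ¬frozen = contradiction ((λ v → punchOut (proj₁ (proj₂ (recolor v)) ∘ ≡-sym)) , pr′) ¬col
  where
  -- No edge has both ends of colour `i`, so the vertices of this class can be recoloured
  -- independently, each with a colour missing around it; all others keep their colour, and
  -- `punchOut` closes the gap at `i`.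
  Fresh : Fin n → Fin (suc m) → Set
  Fresh v j = (c v ≡ i → ∀ u → Adj G v u → c u ≢ j) × (c v ≢ i → j ≡ c v)
  recolor : ∀ v → ∃ λ j → j ≢ i × Fresh v j
  recolor v with c v ≟ i
  ... | no cv≢i = c v , cv≢i , (λ e → contradiction e cv≢i) , (λ _ → refl)
  ... | yes cv≡i with ¬∀⟶∃¬ (suc m) (λ j → j ≢ i → ∃ λ u → Adj G v u × c u ≡ j)
                       (λ j → ¬? (j ≟ i) →-dec any? (λ u → adj? G v u ×-dec (c u ≟ j)))
                       (λ sees → ¬frozen (v , cv≡i , sees))
  ...   | j , ¬sees = j , (λ j≡i → ¬sees (λ j≢i → contradiction j≡i j≢i)) ,
            (λ _ u vu cu → ¬sees (λ _ → u , vu , cu)) , (λ ne → contradiction cv≡i ne)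
  pr′ : ProperColoring G m (λ v → punchOut (proj₁ (proj₂ (recolor v)) ∘ ≡-sym))
  pr′ u v uv eq with recolor u | recolor v
  ... | j , j≢i , fu , gu | l , l≢i , fv , gv with punchOut-injective (j≢i ∘ ≡-sym) (l≢i ∘ ≡-sym) eq | c u ≟ i | c v ≟ i
  ...   | refl | yes cu | yes cv = pr u v uv (trans cu (≡-sym cv))
  ...   | refl | yes cu | no cv  = fu cu v uv (≡-sym (gv cv))
  ...   | refl | no cu  | yes cv = fv cv u (adj-sym G uv) (≡-sym (gu cu))
  ...   | refl | no cu  | no cv  = pr u v uv (trans (≡-sym (gu cu)) (gv cv))

-- Greedy colouring along an order

InjectiveOn : (Fin n → ℕ) → Set
InjectiveOn pr = ∀ {u v} → pr u ≡ pr v → u ≡ v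

maximum : ∀ (q : Fin (suc n) → ℕ) → ∃ λ y → ∀ v → q v ≤ q y
maximum {zero}  q = zero , λ { zero → ≤-refl }
maximum {suc n} q with maximum (q ∘ suc)
... | y , max with ≤-total (q zero) (q (suc y))
...   | inj₁ le = suc y , λ { zero → le ; (suc v) → max v }
...   | inj₂ ge = zero , λ { zero → ≤-refl ; (suc v) → ≤-trans (max v) ge }

last : ∀ (q : Fin (suc n) → ℕ) → InjectiveOn q → ∃ λ y → ∀ v → q (punchIn y v) < q y
last q inj with maximum q
... | y , max = y , λ v → ≤∧≢⇒< (max (punchIn y v)) (λ e → punchInᵢ≢i y v (inj e))

Open : Graph n → (Fin n → ℕ) → Vec (Fin k) n → Fin n → Fin k → Set
Open G pr c v i = ∀ u → Adj G v u → pr u < pr v → lookup c u ≢ i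

open? : ∀ (G : Graph n) pr (c : Vec (Fin k) n) v i → Dec (Open G pr c v i)
open? G pr c v i = all? (λ u → adj? G v u →-dec ((pr u <? pr v) →-dec ¬? (lookup c u ≟ i)))

avail : Graph n → (Fin n → ℕ) → Vec (Fin k) n → Fin n → ℕ
avail {k = k} G pr c v = ∑ (λ i → χ (open? G pr c v i)) (allFin k)

avail-last : ∀ (G : Graph (suc n)) pr y → (∀ v → pr (punchIn y v) < pr y) → ∀ (c : Vec (Fin k) n) i →
  avail G pr (insertAt c y i) y ≡ ∑ (λ j → χ (free? G y c j)) (allFin k)
avail-last {k = k} G pr y max c i = ∑-cong (allFin k) λ j → χ-cong (open? G pr (insertAt c y i) y j) (free? G y c j)
  (λ op u yu e → op (punchIn y u) yu (max u) (trans (insertAt-punchIn c y i u) e))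
  (λ fr → from j fr)
  where
  from : ∀ j → Free G y c j → Open G pr (insertAt c y i) y j
  from j fr u yu lt with punchView y u
  ... | hole    = contradiction lt (<-irrefl refl)
  ... | other a = λ e → fr a yu (trans (≡-sym (insertAt-punchIn c y i a)) e)

avail-delete : ∀ (G : Graph (suc n)) pr y → (∀ v → pr (punchIn y v) < pr y) → ∀ (c : Vec (Fin k) n) i v →
  avail G pr (insertAt c y i) (punchIn y v) ≡ avail (delete G y) (pr ∘ punchIn y) c v
avail-delete {k = k} G pr y max c i v = ∑-cong (allFin k) λ j →
  χ-cong (open? G pr (insertAt c y i) (punchIn y v) j) (open? (delete G y) (pr ∘ punchIn y) c v j)
    (λ op u vu lt e → op (punchIn y u) vu lt (trans (insertAt-punchIn c y i u) e))
    (λ op → from j op)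
  where
  from : ∀ j → Open (delete G y) (pr ∘ punchIn y) c v j → Open G pr (insertAt c y i) (punchIn y v) j
  from j op u vu lt with punchView y u
  ... | hole    = contradiction lt (<⇒≯ (max v))
  ... | other a = λ e → op a vu lt (trans (≡-sym (insertAt-punchIn c y i a)) e)

-- An integral stand-in for the reciprocal of `a`, scaled by `K`. With `K = k !` it is exact for all
-- `a` from 1 to `k`; the value at 0 keeps `codivisor-≤` true when no colour is available.
codivisor : ℕ → ℕ → ℕ
codivisor K zero    = 0
codivisor K (suc a) = K / suc a

codivisor-≤ : ∀ K a → a * codivisor K a ≤ K
codivisor-≤ K zero    = z≤n
codivisor-≤ K (suc a) = ≤-trans (≤-reflexive (*-comm (suc a) (K / suc a))) (m/n*n≤m K (suc a))

codivisor-! : ∀ {a} → 0 < a → a ≤ k → a * codivisor (k !) a ≡ k !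
codivisor-! {k} {suc a} _ a≤k = m*[n/m]≡n (∣-trans (m∣m*n (a !)) (m≤n⇒m!∣n! a≤k))

-- A random greedy colouring along the order produces the proper colouring c with probability
-- ∏ᵥ 1 / avail c v, so these reciprocals add up to at most 1.
∑-greedy-≤ : ∀ K (G : Graph n) pr → InjectiveOn pr →
  ∑ (λ c → χ (proper? G c) * ∏ (λ v → codivisor K (avail G pr c v)) (allFin n)) (allVecs n k) ≤ K ^ n
∑-greedy-≤ {zero} K G pr inj = ≤-trans (≤-reflexive (trans (+-identityʳ _) (*-identityʳ _))) (χ≤1 (proper? G []))
∑-greedy-≤ {suc n} {k} K G pr inj with last pr inj
-- The last vertex `y` affects no other availability. Its `F c` free colours carry weight
-- `codivisor K (F c)` each, together at most `K`.
... | y , max = begin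
  ∑ (λ c → χ (proper? G c) * ∏ (λ v → codivisor K (avail G pr c v)) (allFin (suc n))) (allVecs (suc n) k)
    ≡⟨ ∑-insertAt (λ c → χ (proper? G c) * ∏ (λ v → codivisor K (avail G pr c v)) (allFin (suc n))) y ⟩
  ∑ (λ c → ∑ (λ i → χ (proper? G (insertAt c y i)) * ∏ (λ v → codivisor K (avail G pr (insertAt c y i) v)) (allFin (suc n))) (allFin k)) (allVecs n k)
    ≤⟨ ∑-mono (allVecs n k) inner ⟩
  ∑ (λ c → K * W c) (allVecs n k)
    ≡⟨ ∑-*ˡ K W (allVecs n k) ⟩
  K * ∑ W (allVecs n k)
    ≤⟨ *-monoʳ-≤ K (∑-greedy-≤ K H pr′ (λ e → punchIn-injective y _ _ (inj e))) ⟩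
  K * K ^ n ∎
  where
  open ≤-Reasoning
  H = delete G y
  pr′ = pr ∘ punchIn y
  V : Vec (Fin k) n → ℕ
  V c = ∏ (λ v → codivisor K (avail H pr′ c v)) (allFin n)
  W : Vec (Fin k) n → ℕ
  W c = χ (proper? H c) * V c
  F : Vec (Fin k) n → ℕ
  F c = ∑ (λ j → χ (free? G y c j)) (allFin k)
  term : ∀ c i → χ (proper? G (insertAt c y i)) * ∏ (λ v → codivisor K (avail G pr (insertAt c y i) v)) (allFin (suc n))
    ≡ W c * codivisor K (F c) * χ (free? G y c i)
  term c i = begin-equality
    χ (proper? G (insertAt c y i)) * ∏ g (allFin (suc n))
      ≡⟨ cong₂ _*_ (χ-insertAt G y c i) (∏-remove g y) ⟩
    χ (proper? H c) * χ (free? G y c i) * (g y * ∏ (g ∘ punchIn y) (allFin n))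
      ≡⟨ cong₂ (λ a b → χ (proper? H c) * χ (free? G y c i) * (a * b))
           (cong (codivisor K) (avail-last G pr y max c i))
           (∏-cong (allFin n) (λ v → cong (codivisor K) (avail-delete G pr y max c i v))) ⟩
    χ (proper? H c) * χ (free? G y c i) * (codivisor K (F c) * V c)
      ≡⟨ lem (χ (proper? H c)) (χ (free? G y c i)) (codivisor K (F c)) (V c) ⟩
    W c * codivisor K (F c) * χ (free? G y c i) ∎
    where
    g : Fin (suc n) → ℕ
    g v = codivisor K (avail G pr (insertAt c y i) v)
    lem : ∀ a b c d → a * b * (c * d) ≡ a * d * c * b
    lem = solve-∀
  inner : ∀ c → ∑ (λ i → χ (proper? G (insertAt c y i)) * ∏ (λ v → codivisor K (avail G pr (insertAt c y i) v)) (allFin (suc n))) (allFin k) ≤ K * W c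
  inner c = begin
    ∑ (λ i → χ (proper? G (insertAt c y i)) * ∏ (λ v → codivisor K (avail G pr (insertAt c y i) v)) (allFin (suc n))) (allFin k)
      ≡⟨ ∑-cong (allFin k) (term c) ⟩
    ∑ (λ i → W c * codivisor K (F c) * χ (free? G y c i)) (allFin k)
      ≡⟨ ∑-*ˡ (W c * codivisor K (F c)) (λ i → χ (free? G y c i)) (allFin k) ⟩
    W c * codivisor K (F c) * F c
      ≡⟨ lem (W c) (codivisor K (F c)) (F c) ⟩
    F c * codivisor K (F c) * W c
      ≤⟨ *-monoˡ-≤ (W c) (codivisor-≤ K (F c)) ⟩
    K * W c ∎
    where
    lem : ∀ a b c → a * b * c ≡ c * b * a
    lem = solve-∀

avail-≤ : ∀ (G : Graph n) pr (c : Vec (Fin k) n) v → avail G pr c v ≤ k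
avail-≤ {k = k} G pr c v = begin
  avail G pr c v          ≤⟨ ∑-mono (allFin k) (λ i → χ≤1 (open? G pr c v i)) ⟩
  ∑ (λ _ → 1) (allFin k)  ≡⟨ trans (∑-const 1 (allFin k)) (trans (*-identityʳ _) (length-allFin k)) ⟩
  k                       ∎
  where open ≤-Reasoning

avail>0 : ∀ (G : Graph n) pr (c : Vec (Fin k) n) → ProperColoring G k (lookup c) → ∀ v → 0 < avail G pr c v
avail>0 {k = zero} G pr c _ v with () ← lookup c v
avail>0 {k = suc k} G pr c proper v = begin
  1                                                              ≡⟨ ≡-sym (χ-yes (f i) (λ u vu _ e → proper v u vu (≡-sym e))) ⟩
  χ (f i)                                                        ≤⟨ m≤m+n _ _ ⟩
  χ (f i) + ∑ (λ j → χ (f (punchIn i j))) (allFin k)             ≡⟨ ≡-sym (∑-remove (λ j → χ (f j)) i) ⟩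
  avail G pr c v                                                 ∎
  where
  open ≤-Reasoning
  i = lookup c v
  f = open? G pr c v

-- The entropy bound: the number of colourings is at most the geometric mean of ∏ᵥ avail c v.
entropy : ∀ (G : Graph n) k pr → InjectiveOn pr →
  chromPoly G k ^ chromPoly G k ≤ ∏ (λ c → ∏ (λ v → avail G pr c v) (allFin n)) (cols G k)
-- `Y` is the greedy probability scaled by `M`, so `X c * Y c ≡ M`. AM-GM for `Y`, whose sum is at
-- most `M`, bounds `P ^ P * ∏ Y` by `M ^ P`; multiplying by `∏ X` and cancelling `M ^ P` leaves the
-- claim.
entropy {n} G k pr inj = *-cancelˡ-≤ M^P {{m^n≢0 M P {{m^n≢0 K n {{k !≢0}}}}}} (begin
  M^P * P ^ P                     ≡⟨ cong (_* P ^ P) (≡-sym (∏-const M (cols G k))) ⟩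
  ∏ (λ _ → M) (cols G k) * P ^ P  ≡⟨ cong (_* P ^ P) (∏-cong-∈ (cols G k) (λ c c∈ → ≡-sym (X*Y c (cols-proper G c∈)))) ⟩
  ∏ (λ c → X c * Y c) (cols G k) * P ^ P ≡⟨ cong (_* P ^ P) (∏-distrib X Y (cols G k)) ⟩
  ∏ X (cols G k) * ∏ Y (cols G k) * P ^ P ≡⟨ lem (∏ X (cols G k)) (∏ Y (cols G k)) (P ^ P) ⟩
  P ^ P * ∏ Y (cols G k) * ∏ X (cols G k) ≤⟨ *-monoˡ-≤ (∏ X (cols G k)) (am-gm Y (cols G k)) ⟩
  ∑ Y (cols G k) ^ P * ∏ X (cols G k) ≤⟨ *-monoˡ-≤ (∏ X (cols G k)) (^-monoˡ-≤ P (subst (_≤ M) (≡-sym (∑-cols G Y)) (∑-greedy-≤ K G pr inj))) ⟩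
  M^P * ∏ X (cols G k)            ∎)
  where
  open ≤-Reasoning
  K = k !
  M = K ^ n
  P = chromPoly G k
  M^P = M ^ P
  X Y : Vec (Fin k) n → ℕ
  X c = ∏ (λ v → avail G pr c v) (allFin n)
  Y c = ∏ (λ v → codivisor K (avail G pr c v)) (allFin n)
  lem : ∀ a b c → a * b * c ≡ c * b * a
  lem = solve-∀
  X*Y : ∀ c → ProperColoring G k (lookup c) → X c * Y c ≡ M
  X*Y c proper = begin-equality
    X c * Y c                                                           ≡⟨ ≡-sym (∏-distrib _ _ (allFin n)) ⟩
    ∏ (λ v → avail G pr c v * codivisor K (avail G pr c v)) (allFin n)  ≡⟨ ∏-cong (allFin n) (λ v → codivisor-! (avail>0 G pr c proper v) (avail-≤ G pr c v)) ⟩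
    ∏ (λ _ → K) (allFin n)                                              ≡⟨ trans (∏-const K (allFin n)) (cong (K ^_) (length-allFin n)) ⟩
    M                                                                   ∎

-- Ranks in a random order

rank : (Fin s → ℕ) → Fin s → ℕ
rank {s} q i = ∑ (λ j → χ (q j <? q i)) (allFin s)

∏< : (ℕ → ℕ) → ℕ → ℕ
∏< g zero    = 1
∏< g (suc s) = g s * ∏< g s

-- The ranks are 0, ..., s-1, each once: the largest entry has the top rank, and removing it changes
-- no other rank.
∏-rank : ∀ (g : ℕ → ℕ) (q : Fin s → ℕ) → InjectiveOn q → ∏ (λ i → g (rank q i)) (allFin s) ≡ ∏< g s
∏-rank {zero}  g q inj = refl
∏-rank {suc s} g q inj with last q inj
... | y , max = begin
  ∏ (λ i → g (rank q i)) (allFin (suc s))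
    ≡⟨ ∏-remove (λ i → g (rank q i)) y ⟩
  g (rank q y) * ∏ (λ i → g (rank q (punchIn y i))) (allFin s)
    ≡⟨ cong₂ _*_ (cong g rank-y) (∏-cong (allFin s) (λ i → cong g (rank-other i))) ⟩
  g s * ∏ (λ i → g (rank (q ∘ punchIn y) i)) (allFin s)
    ≡⟨ cong (g s *_) (∏-rank g (q ∘ punchIn y) (λ e → punchIn-injective y _ _ (inj e))) ⟩
  g s * ∏< g s ∎
  where
  open ≡-Reasoning
  rank-y : rank q y ≡ s
  rank-y = begin
    rank q y                                                               ≡⟨ ∑-remove (λ j → χ (q j <? q y)) y ⟩
    χ (q y <? q y) + ∑ (λ j → χ (q (punchIn y j) <? q y)) (allFin s)       ≡⟨ cong₂ _+_ (χ-no (q y <? q y) (<-irrefl refl)) (∑-cong (allFin s) (λ j → χ-yes (q (punchIn y j) <? q y) (max j))) ⟩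
    ∑ (λ _ → 1) (allFin s)                                                 ≡⟨ trans (∑-const 1 (allFin s)) (trans (*-identityʳ _) (length-allFin s)) ⟩
    s                                                                      ∎
  rank-other : ∀ i → rank q (punchIn y i) ≡ rank (q ∘ punchIn y) i
  rank-other i = trans (∑-remove (λ j → χ (q j <? q (punchIn y i))) y)
    (cong (_+ rank (q ∘ punchIn y) i) (χ-no (q y <? q (punchIn y i)) (<⇒≯ (max i))))

involution-↭ : ∀ {xs : List A} (h : A → A) → Unique xs → (∀ x → h (h x) ≡ x) → (∀ {x} → x ∈ xs → h x ∈ xs) →
  map h xs ↭ xs
involution-↭ {xs = xs} h uniq hh closed = ∼bag⇒↭ (unique∧set⇒bag (Unique.map⁺ inj uniq) uniq (λ {x} → mk⇔ to (from x)))
  where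
  inj : ∀ {x y} → h x ≡ h y → x ≡ y
  inj {x} {y} e = trans (≡-sym (hh x)) (trans (cong h e) (hh y))
  to : ∀ {x} → x ∈ map h xs → x ∈ xs
  to x∈ with ∈-map⁻ h x∈
  ... | y , y∈ , refl = closed y∈
  from : ∀ x → x ∈ xs → x ∈ map h xs
  from x x∈ = subst (_∈ map h xs) (hh x) (∈-map⁺ h (closed x∈))

exchange : Fin n → Fin n → Fin n → Fin n
exchange a b u = if does (u ≟ a) then b else (if does (u ≟ b) then a else u)

exchange-left : ∀ (a b : Fin n) → exchange a b a ≡ b
exchange-left a b with a ≟ a
... | yes _ = refl
... | no ¬e = contradiction refl ¬e

exchange-right : ∀ (a b : Fin n) → exchange a b b ≡ a
exchange-right a b with b ≟ a | b ≟ b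
... | yes e | _     = e
... | no _  | yes _ = refl
... | no _  | no ¬e = contradiction refl ¬e

exchange-other : ∀ {a b u : Fin n} → u ≢ a → u ≢ b → exchange a b u ≡ u
exchange-other {a = a} {b} {u} u≢a u≢b with u ≟ a | u ≟ b
... | yes e | _     = contradiction e u≢a
... | no _  | yes e = contradiction e u≢b
... | no _  | no _  = refl

exchange-involutive : ∀ (a b u : Fin n) → exchange a b (exchange a b u) ≡ u
exchange-involutive a b u with u ≟ a | u ≟ b
... | yes refl | _        = exchange-right a b
... | no _     | yes refl = exchange-left a b
... | no u≢a   | no u≢b   = exchange-other u≢a u≢b

exchange-natural : ∀ (t : Fin s → Fin n) → (∀ {i j} → t i ≡ t j → i ≡ j) → ∀ i j l →
  exchange (t i) (t j) (t l) ≡ t (exchange i j l)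
exchange-natural t inj i j l with l ≟ i | l ≟ j
... | yes refl | _        = exchange-left (t l) (t j)
... | no _     | yes refl = exchange-right (t i) (t l)
... | no l≢i   | no l≢j   = exchange-other (l≢i ∘ inj) (l≢j ∘ inj)

concatMap-cartesian : ∀ {D : Set} (f : A → C → D) xs ys → concatMap (λ x → map (f x) ys) xs ≡ cartesianProductWith f xs ys
concatMap-cartesian f []       ys = refl
concatMap-cartesian f (x ∷ xs) ys = cong (map (f x) ys ++_) (concatMap-cartesian f xs ys)

allVecs-unique : ∀ n k → Unique (allVecs n k)
allVecs-unique zero    k = [] ∷ []
allVecs-unique (suc n) k = subst Unique (≡-sym (concatMap-cartesian _∷_ (allFin k) (allVecs n k)))
  (Unique.cartesianProductWith⁺ _∷_ ∷-injective (Unique.allFin⁺ k) (allVecs-unique n k))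

InjectiveVec : Vec (Fin k) n → Set
InjectiveVec ω = ∀ u v → lookup ω u ≡ lookup ω v → u ≡ v

injectiveVec? : ∀ (ω : Vec (Fin k) n) → Dec (InjectiveVec ω)
injectiveVec? ω = all? (λ u → all? (λ v → (lookup ω u ≟ lookup ω v) →-dec (u ≟ v)))

-- An order of the vertices is given by the injective vector of their positions.
orders : ∀ n → List (Vec (Fin n) n)
orders n = filter injectiveVec? (allVecs n n)

position : Vec (Fin n) n → Fin n → ℕ
position ω u = toℕ (lookup ω u)

orders-injective : ∀ {ω} → ω ∈ orders n → InjectiveOn (position ω)
orders-injective {n} {ω} ω∈ e = proj₂ (∈-filter⁻ injectiveVec? {xs = allVecs n n} ω∈) _ _ (toℕ-injective e)

orders>0 : ∀ n → 0 < length (orders n)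
orders>0 n with orders n | ∈-filter⁺ injectiveVec? (allVecs-complete (tabulate id)) identity-injective
  where
  identity-injective : InjectiveVec (tabulate {n = n} id)
  identity-injective u v e = trans (≡-sym (lookup∘tabulate id u)) (trans e (lookup∘tabulate id v))
... | _ ∷ _ | _ = s≤s z≤n

relabel : (Fin n → Fin n) → Vec (Fin k) n → Vec (Fin k) n
relabel τ ω = tabulate (lookup ω ∘ τ)

-- Relabelling by a transposition is an involution on the orders, so it only permutes the factors.
-- Transpositions suffice, because only the roles of two vertices `t i` and `t j` have to be
-- exchanged.
∏-relabel : ∀ (F : Vec (Fin n) n → ℕ) a b → ∏ F (orders n) ≡ ∏ (F ∘ relabel (exchange a b)) (orders n)
∏-relabel {n} F a b = trans (≡-sym (∏-↭ F (involution-↭ (relabel τ) (Unique.filter⁺ injectiveVec? (allVecs-unique n n)) relabel-involutive closed)))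
  (∏-map F (relabel τ) (orders n))
  where
  τ = exchange a b
  relabel-involutive : ∀ ω → relabel τ (relabel τ ω) ≡ ω
  relabel-involutive ω = trans (tabulate-cong (λ u → trans (lookup∘tabulate (lookup ω ∘ τ) (τ u)) (cong (lookup ω) (exchange-involutive a b u))))
    (tabulate∘lookup ω)
  closed : ∀ {ω} → ω ∈ orders n → relabel τ ω ∈ orders n
  closed {ω} ω∈ = ∈-filter⁺ injectiveVec? (allVecs-complete (relabel τ ω)) λ u v e →
    trans (≡-sym (exchange-involutive a b u)) (trans (cong τ (proj₂ (∈-filter⁻ injectiveVec? {xs = allVecs n n} ω∈) (τ u) (τ v)
      (trans (≡-sym (lookup∘tabulate (lookup ω ∘ τ) u)) (trans e (lookup∘tabulate (lookup ω ∘ τ) v))))) (exchange-involutive a b v))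

-- The exchange permutes the positions of the vertices `t l` among themselves, so the position of
-- `t i`, now held by `t j`, is compared with the same collection.
rank-relabel : ∀ (t : Fin s → Fin n) → (∀ {i j} → t i ≡ t j → i ≡ j) → ∀ i j ω →
  rank (position (relabel (exchange (t i) (t j)) ω) ∘ t) j ≡ rank (position ω ∘ t) i
rank-relabel {s} t inj i j ω = begin
  ∑ (λ l → χ (q′ l <? q′ j)) (allFin s)
    ≡⟨ ∑-cong (allFin s) (λ l → cong₂ (λ a b → χ (a <? b)) (q′≡ l) (trans (q′≡ j) (cong q (exchange-right i j)))) ⟩
  ∑ (λ l → χ (q (exchange i j l) <? q i)) (allFin s)
    ≡⟨ ≡-sym (∑-map (λ l → χ (q l <? q i)) (exchange i j) (allFin s)) ⟩
  ∑ (λ l → χ (q l <? q i)) (map (exchange i j) (allFin s))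
    ≡⟨ ∑-↭ (λ l → χ (q l <? q i)) (involution-↭ (exchange i j) (Unique.allFin⁺ s) (exchange-involutive i j) (λ {l} _ → ∈-allFin (exchange i j l))) ⟩
  ∑ (λ l → χ (q l <? q i)) (allFin s) ∎
  where
  open ≡-Reasoning
  τ = exchange (t i) (t j)
  q = position ω ∘ t
  q′ = position (relabel τ ω) ∘ t
  q′≡ : ∀ l → q′ l ≡ q (exchange i j l)
  q′≡ l = cong toℕ (trans (lookup∘tabulate (lookup ω ∘ τ) (t l)) (cong (lookup ω) (exchange-natural t inj i j l)))

-- In a random order every rank of t i among the s vertices t 0, …, t (s-1) is equally likely.
∏-orders-rank : ∀ (g : ℕ → ℕ) (t : Fin s → Fin n) → (∀ {i j} → t i ≡ t j → i ≡ j) → ∀ i →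
  ∏ (λ ω → g (rank (position ω ∘ t) i)) (orders n) ^ s ≡ ∏< g s ^ length (orders n)
∏-orders-rank {s} {n} g t inj i = begin
  R i ^ s                                                            ≡⟨ cong (R i ^_) (≡-sym (length-allFin s)) ⟩
  R i ^ length (allFin s)                                            ≡⟨ ≡-sym (∏-const (R i) (allFin s)) ⟩
  ∏ (λ _ → R i) (allFin s)                                           ≡⟨ ∏-cong (allFin s) symmetric ⟩
  ∏ (λ j → R j) (allFin s)                                           ≡⟨ ∏-swap (λ j ω → g (rank (position ω ∘ t) j)) (allFin s) (orders n) ⟩
  ∏ (λ ω → ∏ (λ j → g (rank (position ω ∘ t) j)) (allFin s)) (orders n) ≡⟨ ∏-cong-∈ (orders n) (λ ω ω∈ → ∏-rank g (position ω ∘ t) (λ e → inj (orders-injective ω∈ e))) ⟩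
  ∏ (λ _ → ∏< g s) (orders n)                                        ≡⟨ ∏-const (∏< g s) (orders n) ⟩
  ∏< g s ^ length (orders n)                                         ∎
  where
  open ≡-Reasoning
  R : Fin s → ℕ
  R j = ∏ (λ ω → g (rank (position ω ∘ t) j)) (orders n)
  symmetric : ∀ j → R i ≡ R j
  symmetric j = ≡-sym (trans (∏-relabel (λ ω → g (rank (position ω ∘ t) j)) (t i) (t j))
    (∏-cong (orders n) (λ ω → cong g (rank-relabel t inj i j ω))))

-- Bounds for the number of available colours

∏<-∸ : ∀ k s → s ≤ k → ∏< (k ∸_) s * (k ∸ s) ! ≡ k !
∏<-∸ k zero    _   = *-identityˡ (k !)
∏<-∸ k (suc s) s<k = begin
  (k ∸ s) * ∏< (k ∸_) s * (k ∸ suc s) !        ≡⟨ lem (k ∸ s) (∏< (k ∸_) s) ((k ∸ suc s) !) ⟩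
  ∏< (k ∸_) s * ((k ∸ s) * (k ∸ suc s) !)      ≡⟨ cong (∏< (k ∸_) s *_) (unfold (k ∸ s) (m<n⇒0<n∸m s<k) (pred[m∸n]≡m∸[1+n] k s)) ⟩
  ∏< (k ∸_) s * (k ∸ s) !                      ≡⟨ ∏<-∸ k s (<⇒≤ s<k) ⟩
  k !                                          ∎
  where
  open ≡-Reasoning
  lem : ∀ a b c → a * b * c ≡ b * (a * c)
  lem = solve-∀
  unfold : ∀ a {b} → 0 < a → pred a ≡ b → a * b ! ≡ a !
  unfold (suc a) _ refl = refl

-- The neighbours `t j` have pairwise different colours, so each one that precedes `t i` blocks a
-- colour of its own, and the rank counts them.
avail-frozen : ∀ (G : Graph n) pr (c : Vec (Fin k) n) (t : Fin k → Fin n) i →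
  (∀ j → lookup c (t j) ≡ j) → (∀ j → j ≢ i → Adj G (t i) (t j)) → avail G pr c (t i) ≤ k ∸ rank (pr ∘ t) i
avail-frozen {k = k} G pr c t i c∘t t-adj = m+n≤o⇒m≤o∸n (avail G pr c (t i)) (begin
  avail G pr c (t i) + rank (pr ∘ t) i
    ≡⟨ ≡-sym (∑-distrib (λ j → χ (open? G pr c (t i) j)) (λ j → χ (pr (t j) <? pr (t i))) (allFin k)) ⟩
  ∑ (λ j → χ (open? G pr c (t i) j) + χ (pr (t j) <? pr (t i))) (allFin k)
    ≤⟨ ∑-mono (allFin k) term ⟩
  ∑ (λ _ → 1) (allFin k)
    ≡⟨ trans (∑-const 1 (allFin k)) (trans (*-identityʳ _) (length-allFin k)) ⟩
  k ∎)
  where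
  open ≤-Reasoning
  term : ∀ j → χ (open? G pr c (t i) j) + χ (pr (t j) <? pr (t i)) ≤ 1
  term j with open? G pr c (t i) j | pr (t j) <? pr (t i)
  ... | no _   | lt?    = χ≤1 lt?
  ... | yes _  | no _   = ≤-refl
  ... | yes op | yes lt = contradiction (c∘t j) (op (t j) (t-adj j (λ { refl → <-irrefl refl lt })) lt)

-- Upper bounds for the available colours at a vertex with three fixed neighbours, as a function of
-- how many of them come earlier; they differ when all three do.
mixed mono : ℕ → ℕ → ℕ
mixed p 0 = 2 + p
mixed p 1 = 1 + p
mixed p 2 = 1 + p
mixed p _ = p
mono p zero    = 2 + p
mono p (suc _) = 1 + p

star : Fin n → Fin n → Fin n → Fin n → Fin 4 → Fin n
star v x y z = lookup (v ∷ x ∷ y ∷ z ∷ [])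

star-injective : ∀ (G : Graph n) {v x y z} → Adj G v x → Adj G v y → Adj G v z → x ≢ y → x ≢ z → y ≢ z →
  ∀ {i j} → star v x y z i ≡ star v x y z j → i ≡ j
star-injective G {v} {x} {y} {z} vx vy vz x≢y x≢z y≢z = inj _ _
  where
  inj : ∀ i j → star v x y z i ≡ star v x y z j → i ≡ j
  inj zero zero e = refl
  inj zero (suc zero) e = contradiction e (adj⇒≢ G vx)
  inj zero (suc (suc zero)) e = contradiction e (adj⇒≢ G vy)
  inj zero (suc (suc (suc zero))) e = contradiction e (adj⇒≢ G vz)
  inj (suc zero) zero e = contradiction (≡-sym e) (adj⇒≢ G vx)
  inj (suc zero) (suc zero) e = refl
  inj (suc zero) (suc (suc zero)) e = contradiction e x≢y
  inj (suc zero) (suc (suc (suc zero))) e = contradiction e x≢z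
  inj (suc (suc zero)) zero e = contradiction (≡-sym e) (adj⇒≢ G vy)
  inj (suc (suc zero)) (suc zero) e = contradiction (≡-sym e) x≢y
  inj (suc (suc zero)) (suc (suc zero)) e = refl
  inj (suc (suc zero)) (suc (suc (suc zero))) e = contradiction e y≢z
  inj (suc (suc (suc zero))) zero e = contradiction (≡-sym e) (adj⇒≢ G vz)
  inj (suc (suc (suc zero))) (suc zero) e = contradiction (≡-sym e) x≢z
  inj (suc (suc (suc zero))) (suc (suc zero)) e = contradiction (≡-sym e) y≢z
  inj (suc (suc (suc zero))) (suc (suc (suc zero))) e = refl

module _ {p} (G : Graph n) (pr : Fin n → ℕ) (c : Vec (Fin (2 + p)) n) {v x y z : Fin n}
  (vx : Adj G v x) (vy : Adj G v y) (vz : Adj G v z) where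

  private
    avoid : ∀ {u} → Adj G v u → pr u < pr v → avail G pr c v ≤ 1 + p
    avoid {u} vu lt = count-avoid-one (open? G pr c v) (lookup c u) (λ op → op u vu lt refl)

    avoid₂ : ∀ {u w} → Adj G v u → Adj G v w → lookup c u ≢ lookup c w → pr u < pr v → pr w < pr v → avail G pr c v ≤ p
    avoid₂ {u} {w} vu vw ne ltu ltw =
      ≤-pred (count-avoid-two (open? G pr c v) ne (λ op → op u vu ltu refl) (λ op → op w vw ltw refl))

  avail-mono : avail G pr c v ≤ mono p (rank (pr ∘ star v x y z) zero)
  avail-mono with pr v <? pr v | pr x <? pr v | pr y <? pr v | pr z <? pr v
  ... | yes lt | _      | _      | _      = contradiction lt (<-irrefl refl)
  ... | no _   | yes lt | _      | _      = avoid vx lt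
  ... | no _   | no _   | yes lt | _      = avoid vy lt
  ... | no _   | no _   | no _   | yes lt = avoid vz lt
  ... | no _   | no _   | no _   | no _   = avail-≤ G pr c v

  -- Two earlier neighbours may share their colour; only when all three precede `v` is a second
  -- blocked colour certain.
  avail-mixed : ¬ (lookup c x ≡ lookup c y × lookup c x ≡ lookup c z) →
    avail G pr c v ≤ mixed p (rank (pr ∘ star v x y z) zero)
  avail-mixed ne with pr v <? pr v | pr x <? pr v | pr y <? pr v | pr z <? pr v
  ... | yes lt | _      | _      | _      = contradiction lt (<-irrefl refl)
  ... | no _   | no _   | no _   | no _   = avail-≤ G pr c v
  ... | no _   | yes lt | no _   | no _   = avoid vx lt
  ... | no _   | no _   | yes lt | no _   = avoid vy lt
  ... | no _   | no _   | no _   | yes lt = avoid vz lt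
  ... | no _   | yes lt | yes _  | no _   = avoid vx lt
  ... | no _   | yes lt | no _   | yes _  = avoid vx lt
  ... | no _   | no _   | yes lt | yes _  = avoid vy lt
  ... | no _   | yes l₁ | yes l₂ | yes l₃ with lookup c x ≟ lookup c y
  ...   | no x≢y  = avoid₂ vx vy x≢y l₁ l₂
  ...   | yes x≡y = avoid₂ vx vz (λ x≡z → ne (x≡y , x≡z)) l₁ l₃

-- Exponent bookkeeping for products of geometric means

^-cancelʳ-≤ : ∀ e .{{_ : NonZero e}} {x y} → x ^ e ≤ y ^ e → x ≤ y
^-cancelʳ-≤ e {x} {y} le = ≮⇒≥ λ y<x → <⇒≱ (^-monoˡ-< e y<x) le

^-comm : ∀ x s t → (x ^ s) ^ t ≡ (x ^ t) ^ s
^-comm x s t = trans (^-*-assoc x s t) (trans (cong (x ^_) (*-comm s t)) (≡-sym (^-*-assoc x t s)))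

^-power : ∀ {x W N E} s j → s * j ≡ E → x ^ s ≤ W ^ N → x ^ E ≤ (W ^ j) ^ N
^-power {x} {W} {N} s j refl le = begin
  x ^ (s * j)      ≡⟨ ≡-sym (^-*-assoc x s j) ⟩
  (x ^ s) ^ j      ≤⟨ ^-monoˡ-≤ j le ⟩
  (W ^ N) ^ j      ≡⟨ ^-comm W N j ⟩
  (W ^ j) ^ N      ∎
  where open ≤-Reasoning

^-combine : ∀ {W x y z} N → x ≤ W ^ N → W * y ≤ z → x * y ^ N ≤ z ^ N
^-combine {W} {x} {y} {z} N h₁ h₂ = begin
  x * y ^ N        ≤⟨ *-monoˡ-≤ (y ^ N) h₁ ⟩
  W ^ N * y ^ N    ≡⟨ ≡-sym (^-distribʳ-* W y N) ⟩
  (W * y) ^ N      ≤⟨ ^-monoˡ-≤ N h₂ ⟩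
  z ^ N            ∎
  where open ≤-Reasoning

-- With `x` the product of a vertex factor over `N` orders, each case says that its geometric mean,
-- raised to the power 4k, is at most b (d/b)^δ (e/a)^μ, with denominators cleared. Here δ marks
-- designated vertices and μ monochromatic triples. The exponent 4k serves both the ranks among 4
-- vertices and those among k.
module Weights {a b d e : ℕ} where

  -- A designated vertex may have a monochromatic triple as well. Its bound does without the factor
  -- `e / a`, which is at least 1 and is given away so that triples can be counted at all vertices
  -- alike.
  designated-case : ∀ x k N μ {K} → K ^ 4 ≡ d → a ≤ e → x ^ k ≤ K ^ N →
    x ^ (4 * k) * (a ^ μ * b ^ 1) ^ N ≤ (d ^ 1 * b * e ^ μ) ^ N
  designated-case x k N μ {K} refl a≤e le = ^-combine {K ^ 4} N (^-power {x} {K} {N} k 4 (*-comm k 4) le) (begin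
    K ^ 4 * (a ^ μ * (b * 1))     ≡⟨ lem (K ^ 4) (a ^ μ) b ⟩
    (K ^ 4) ^ 1 * b * a ^ μ       ≤⟨ *-monoʳ-≤ ((K ^ 4) ^ 1 * b) (^-monoˡ-≤ μ a≤e) ⟩
    (K ^ 4) ^ 1 * b * e ^ μ       ∎)
    where
    open ≤-Reasoning
    lem : ∀ d a b → d * (a * (b * 1)) ≡ d * 1 * b * a
    lem = solve-∀

  mono-case : ∀ x k N {W} → W ^ k * a ≡ b * e → x ^ 4 ≤ W ^ N →
    x ^ (4 * k) * (a ^ 1 * b ^ 0) ^ N ≤ (d ^ 0 * b * e ^ 1) ^ N
  mono-case x k N {W} eq le = ^-combine {W ^ k} N (^-power {x} {W} {N} 4 k refl le)
    (≤-reflexive (trans (lem₁ (W ^ k) a) (trans eq (lem₂ b e))))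
    where
    lem₁ : ∀ x a → x * (a * 1 * 1) ≡ x * a
    lem₁ = solve-∀
    lem₂ : ∀ b e → b * e ≡ 1 * b * (e * 1)
    lem₂ = solve-∀

  mixed-case : ∀ x k N {M} → M ^ k ≡ b → x ^ 4 ≤ M ^ N →
    x ^ (4 * k) * (a ^ 0 * b ^ 0) ^ N ≤ (d ^ 0 * b * e ^ 0) ^ N
  mixed-case x k N {M} refl le = ^-combine {M ^ k} N (^-power {x} {M} {N} 4 k refl le) (≤-reflexive (lem (M ^ k)))
    where
    lem : ∀ b → b * (1 * 1) ≡ 1 * b * 1
    lem = solve-∀

  ∏-vertices : ∀ {E N k n} (Vs : List A) (f μ δ : A → ℕ) → ∑ δ Vs ≡ k → length Vs ≡ n →
    (∀ v → f v ^ E * (a ^ μ v * b ^ δ v) ^ N ≤ (d ^ δ v * b * e ^ μ v) ^ N) →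
    ∏ f Vs ^ E * (a ^ ∑ μ Vs * b ^ k) ^ N ≤ (d ^ k * b ^ n * e ^ ∑ μ Vs) ^ N
  ∏-vertices {E = E} {N} Vs f μ δ refl refl le = begin
    ∏ f Vs ^ E * (a ^ ∑ μ Vs * b ^ ∑ δ Vs) ^ N
      ≡⟨ cong₂ (λ s t → s * t ^ N) (≡-sym (∏-^ f E Vs)) (cong₂ _*_ (≡-sym (∏-^-∑ a μ Vs)) (≡-sym (∏-^-∑ b δ Vs))) ⟩
    ∏ (λ v → f v ^ E) Vs * (∏ (λ v → a ^ μ v) Vs * ∏ (λ v → b ^ δ v) Vs) ^ N
      ≡⟨ cong (∏ (λ v → f v ^ E) Vs *_) (trans (cong (_^ N) (≡-sym (∏-distrib (λ v → a ^ μ v) (λ v → b ^ δ v) Vs)))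
           (≡-sym (∏-^ (λ v → a ^ μ v * b ^ δ v) N Vs))) ⟩
    ∏ (λ v → f v ^ E) Vs * ∏ (λ v → (a ^ μ v * b ^ δ v) ^ N) Vs
      ≡⟨ ≡-sym (∏-distrib (λ v → f v ^ E) (λ v → (a ^ μ v * b ^ δ v) ^ N) Vs) ⟩
    ∏ (λ v → f v ^ E * (a ^ μ v * b ^ δ v) ^ N) Vs
      ≤⟨ ∏-mono-∈ Vs (λ v _ → le v) ⟩
    ∏ (λ v → (d ^ δ v * b * e ^ μ v) ^ N) Vs
      ≡⟨ ∏-^ (λ v → d ^ δ v * b * e ^ μ v) N Vs ⟩
    ∏ (λ v → d ^ δ v * b * e ^ μ v) Vs ^ N
      ≡⟨ cong (_^ N) (trans (∏-distrib (λ v → d ^ δ v * b) (λ v → e ^ μ v) Vs)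
           (cong (_* ∏ (λ v → e ^ μ v) Vs) (∏-distrib (λ v → d ^ δ v) (λ _ → b) Vs))) ⟩
    (∏ (λ v → d ^ δ v) Vs * ∏ (λ _ → b) Vs * ∏ (λ v → e ^ μ v) Vs) ^ N
      ≡⟨ cong (_^ N) (cong₂ _*_ (cong₂ _*_ (∏-^-∑ d δ Vs) (∏-const b Vs)) (∏-^-∑ e μ Vs)) ⟩
    (d ^ ∑ δ Vs * b ^ length Vs * e ^ ∑ μ Vs) ^ N ∎
    where open ≤-Reasoning

  ∏-colorings : ∀ {E N B D} (Cs : List A) (f u : A → ℕ) →
    (∀ c → c ∈ Cs → f c ^ E * (a ^ u c * B) ^ N ≤ (D * e ^ u c) ^ N) →
    ∏ f Cs ^ E * (a ^ ∑ u Cs * B ^ length Cs) ^ N ≤ (D ^ length Cs * e ^ ∑ u Cs) ^ N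
  ∏-colorings {E = E} {N} {B} {D} Cs f u le = begin
    ∏ f Cs ^ E * (a ^ ∑ u Cs * B ^ length Cs) ^ N
      ≡⟨ cong₂ (λ s t → s * t ^ N) (≡-sym (∏-^ f E Cs)) (trans (cong₂ _*_ (≡-sym (∏-^-∑ a u Cs)) (≡-sym (∏-const B Cs)))
           (≡-sym (∏-distrib (λ c → a ^ u c) (λ _ → B) Cs))) ⟩
    ∏ (λ c → f c ^ E) Cs * ∏ (λ c → a ^ u c * B) Cs ^ N
      ≡⟨ trans (cong (∏ (λ c → f c ^ E) Cs *_) (≡-sym (∏-^ (λ c → a ^ u c * B) N Cs)))
           (≡-sym (∏-distrib (λ c → f c ^ E) (λ c → (a ^ u c * B) ^ N) Cs)) ⟩
    ∏ (λ c → f c ^ E * (a ^ u c * B) ^ N) Cs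
      ≤⟨ ∏-mono-∈ Cs le ⟩
    ∏ (λ c → (D * e ^ u c) ^ N) Cs
      ≡⟨ ∏-^ (λ c → D * e ^ u c) N Cs ⟩
    ∏ (λ c → D * e ^ u c) Cs ^ N
      ≡⟨ cong (_^ N) (trans (∏-distrib (λ _ → D) (λ c → e ^ u c) Cs) (cong₂ _*_ (∏-const D Cs) (∏-^-∑ e u Cs))) ⟩
    (D ^ length Cs * e ^ ∑ u Cs) ^ N ∎
    where open ≤-Reasoning

-- All factors are k-th powers up to rearrangement, so the exponents `N` and `k` cancel by strict
-- monotonicity of powers; the number of orders disappears.
extract-roots : ∀ {P K M p m k n U F} N .{{_ : NonZero N}} .{{_ : NonZero k}} → (P ^ P) ^ N ≤ F →
  F ^ (4 * k) * ((p ^ k) ^ U * ((M ^ k) ^ k) ^ P) ^ N ≤ ((((K ^ 4) ^ k) * (M ^ k) ^ n) ^ P * (m ^ k) ^ U) ^ N →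
  (P ^ 4) ^ P * p ^ U * (M ^ k) ^ P ≤ (K ^ 4) ^ P * (M ^ n) ^ P * m ^ U
extract-roots {P} {K} {M} {p} {m} {k} {n} {U} {F} N ent tot = ^-cancelʳ-≤ k (^-cancelʳ-≤ N (begin
  (((P ^ 4) ^ P * p ^ U * (M ^ k) ^ P) ^ k) ^ N
    ≡⟨ cong (_^ N) left ⟩
  ((P ^ P) ^ (4 * k) * R) ^ N
    ≡⟨ trans (^-distribʳ-* ((P ^ P) ^ (4 * k)) R N) (cong (_* R ^ N) (^-comm (P ^ P) (4 * k) N)) ⟩
  ((P ^ P) ^ N) ^ (4 * k) * R ^ N
    ≤⟨ *-monoˡ-≤ (R ^ N) (^-monoˡ-≤ (4 * k) ent) ⟩
  F ^ (4 * k) * R ^ N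
    ≤⟨ tot ⟩
  ((((K ^ 4) ^ k) * (M ^ k) ^ n) ^ P * (m ^ k) ^ U) ^ N
    ≡⟨ cong (_^ N) (≡-sym right) ⟩
  (((K ^ 4) ^ P * (M ^ n) ^ P * m ^ U) ^ k) ^ N ∎))
  where
  open ≤-Reasoning
  R = (p ^ k) ^ U * ((M ^ k) ^ k) ^ P
  ^-distrib₃ : ∀ x y z → (x * y * z) ^ k ≡ x ^ k * y ^ k * z ^ k
  ^-distrib₃ x y z = trans (^-distribʳ-* (x * y) z k) (cong (_* z ^ k) (^-distribʳ-* x y k))
  left : ((P ^ 4) ^ P * p ^ U * (M ^ k) ^ P) ^ k ≡ (P ^ P) ^ (4 * k) * R
  left = trans (^-distrib₃ ((P ^ 4) ^ P) (p ^ U) ((M ^ k) ^ P)) (trans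
    (cong₂ _*_ (cong₂ _*_ (trans (cong (_^ k) (^-comm P 4 P)) (^-*-assoc (P ^ P) 4 k)) (^-comm p U k)) (^-comm (M ^ k) P k))
    (*-assoc ((P ^ P) ^ (4 * k)) ((p ^ k) ^ U) (((M ^ k) ^ k) ^ P)))
  right : ((K ^ 4) ^ P * (M ^ n) ^ P * m ^ U) ^ k ≡ (((K ^ 4) ^ k) * (M ^ k) ^ n) ^ P * (m ^ k) ^ U
  right = trans (^-distrib₃ ((K ^ 4) ^ P) ((M ^ n) ^ P) (m ^ U)) (trans
    (cong₂ _*_ (cong₂ _*_ (^-comm (K ^ 4) P k) (trans (^-comm (M ^ n) P k) (cong (_^ P) (^-comm M n k)))) (^-comm m U k))
    (cong (_* (m ^ k) ^ U) (≡-sym (^-distribʳ-* ((K ^ 4) ^ k) ((M ^ k) ^ n) P))))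

-- The entropy bound for random orders

-- The two products differ only at rank 3, where `mono` has m and `mixed` has p; so m/p is the price
-- of a monochromatic triple.
swap-weights : ∀ p k → ∏< (mono p) 4 ^ k * p ^ k ≡ ∏< (mixed p) 4 ^ k * suc p ^ k
swap-weights p k = trans (≡-sym (^-distribʳ-* (∏< (mono p) 4) p k)) (trans (cong (_^ k) (lem p)) (^-distribʳ-* (∏< (mixed p) 4) (suc p) k))
  where
  lem : ∀ p → (suc p * (suc p * (suc p * ((2 + p) * 1)))) * p ≡ (p * (suc p * (suc p * ((2 + p) * 1)))) * suc p
  lem = solve-∀

module Counting {p} (G : Graph n) (¬col : ¬ Colorable G (suc p)) (nb : ∀ v → ThreeNeighbours G v) where

  m k′ N K M P : ℕ
  m = suc p
  k′ = suc m
  N = length (orders n)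
  K = k′ !
  M = ∏< (mixed p) 4
  P = chromPoly G k′

  X Y Z : Fin n → Fin n
  X v = proj₁ (nb v)
  Y v = proj₁ (proj₂ (nb v))
  Z v = proj₁ (proj₂ (proj₂ (nb v)))

  T : Fin n → Fin 4 → Fin n
  T v = star v (X v) (Y v) (Z v)

  T-injective : ∀ v {i j} → T v i ≡ T v j → i ≡ j
  T-injective v with nb v
  ... | x , y , z , (vx , vy , vz) , (x≢y , x≢z , y≢z) = star-injective G vx vy vz x≢y x≢z y≢z

  Φ : Fin n → Vec (Fin k′) n → ℕ
  Φ v c = ∏ (λ ω → avail G (position ω) c v) (orders n)

  equal? : ∀ v (c : Vec (Fin k′) n) → Dec (Equal₃ G (X v) (Y v) (Z v) c)
  equal? v = equal₃? G (X v) (Y v) (Z v)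

  Φ-rank : ∀ {s} (g : ℕ → ℕ) (t : Fin s → Fin n) → (∀ {i j} → t i ≡ t j → i ≡ j) → ∀ i c →
    (∀ ω → avail G (position ω) c (t i) ≤ g (rank (position ω ∘ t) i)) → Φ (t i) c ^ s ≤ ∏< g s ^ N
  Φ-rank {s} g t inj i c le = ≤-trans (^-monoˡ-≤ s (∏-mono-∈ (orders n) (λ ω _ → le ω)))
    (≤-reflexive (∏-orders-rank g t inj i))

  a b d e : ℕ
  a = p ^ k′
  b = M ^ k′
  d = K ^ 4
  e = m ^ k′

  open Weights

  module _ (c : Vec (Fin k′) n) (proper : ProperColoring G k′ (lookup c)) where

    rep : Fin k′ → Fin n
    rep i = proj₁ (frozen G ¬col (lookup c) proper i) i

    c∘rep : ∀ i → lookup c (rep i) ≡ i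
    c∘rep i = proj₁ (proj₂ (frozen G ¬col (lookup c) proper i)) i

    -- A class may contain several frozen vertices; designating just one per colour gives exactly
    -- `k′` vertices with the factorial bound, to match the k! of the target.
    designated? : ∀ v → Dec (v ≡ rep (lookup c v))
    designated? v = v ≟ rep (lookup c v)

    ∑-designated : ∑ (λ v → χ (designated? v)) (allFin n) ≡ k′
    ∑-designated = begin
      ∑ (λ v → χ (designated? v)) (allFin n)                      ≡⟨ ∑-cong (allFin n) (λ v → ≡-sym (unique v)) ⟩
      ∑ (λ v → ∑ (λ i → χ (v ≟ rep i)) (allFin k′)) (allFin n)    ≡⟨ ∑-swap (λ v i → χ (v ≟ rep i)) (allFin n) (allFin k′) ⟩
      ∑ (λ i → ∑ (λ v → χ (v ≟ rep i)) (allFin n)) (allFin k′)    ≡⟨ ∑-cong (allFin k′) (λ i → ∑χ≟ (rep i)) ⟩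
      ∑ (λ _ → 1) (allFin k′)                                     ≡⟨ trans (∑-const 1 (allFin k′)) (trans (*-identityʳ _) (length-allFin k′)) ⟩
      k′                                                          ∎
      where
      open ≡-Reasoning
      unique : ∀ v → ∑ (λ i → χ (v ≟ rep i)) (allFin k′) ≡ χ (designated? v)
      unique v = begin
        ∑ (λ i → χ (v ≟ rep i)) (allFin k′)
          ≡⟨ ∑-remove (λ i → χ (v ≟ rep i)) (lookup c v) ⟩
        χ (designated? v) + ∑ (λ i → χ (v ≟ rep (punchIn (lookup c v) i))) (allFin m)
          ≡⟨ cong (χ (designated? v) +_) (trans (∑-cong (allFin m) (λ i → χ-no (v ≟ rep (punchIn (lookup c v) i))
               (λ eq → punchInᵢ≢i (lookup c v) i (trans (≡-sym (c∘rep (punchIn (lookup c v) i))) (cong (lookup c) (≡-sym eq)))))) (∑-zero (allFin m))) ⟩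
        χ (designated? v) + 0
          ≡⟨ +-identityʳ _ ⟩
        χ (designated? v) ∎

    Φ-designated : ∀ i → Φ (rep i) c ^ k′ ≤ K ^ N
    Φ-designated i with frozen G ¬col (lookup c) proper i
    ... | t , c∘t , t-adj = ≤-trans
      (Φ-rank (k′ ∸_) t (λ {i} {j} eq → trans (≡-sym (c∘t i)) (trans (cong (lookup c) eq) (c∘t j))) i c
        (λ ω → avail-frozen G (position ω) c t i c∘t t-adj))
      (≤-reflexive (cong (_^ N) ∏<≡K))
      where
      ∏<≡K : ∏< (k′ ∸_) k′ ≡ K
      ∏<≡K = trans (≡-sym (*-identityʳ _)) (trans (cong (λ j → ∏< (k′ ∸_) k′ * j !) (≡-sym (n∸n≡0 k′))) (∏<-∸ k′ k′ ≤-refl))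

    Φ-mono : ∀ v → Φ v c ^ 4 ≤ ∏< (mono p) 4 ^ N
    Φ-mono v = Φ-rank (mono p) (T v) (T-injective v) zero c λ ω →
      let (vx , vy , vz) = proj₁ (proj₂ (proj₂ (proj₂ (nb v)))) in avail-mono G (position ω) c vx vy vz

    Φ-mixed : ∀ v → ¬ Equal₃ G (X v) (Y v) (Z v) c → Φ v c ^ 4 ≤ M ^ N
    Φ-mixed v ne = Φ-rank (mixed p) (T v) (T-injective v) zero c λ ω →
      let (vx , vy , vz) = proj₁ (proj₂ (proj₂ (proj₂ (nb v)))) in
      avail-mixed G (position ω) c vx vy vz (λ (xy , xz) → ne ((proper , xy) , xz))

    vertex-bound : ∀ v → Φ v c ^ (4 * k′) * (a ^ χ (equal? v c) * b ^ χ (designated? v)) ^ N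
                       ≤ (d ^ χ (designated? v) * b * e ^ χ (equal? v c)) ^ N
    vertex-bound v with designated? v | equal? v c
    ... | yes des | eq? = designated-case {a} {b} {d} {e} (Φ v c) k′ N (χ eq?) {K} refl (^-monoˡ-≤ k′ (n≤1+n p))
      (subst (λ u → Φ u c ^ k′ ≤ K ^ N) (≡-sym des) (Φ-designated (lookup c v)))
    ... | no _ | yes _ = mono-case {a} {b} {d} {e} (Φ v c) k′ N {∏< (mono p) 4} (swap-weights p k′) (Φ-mono v)
    ... | no _ | no ne = mixed-case {a} {b} {d} {e} (Φ v c) k′ N {M} refl (Φ-mixed v ne)

    coloring-bound : ∏ (λ v → Φ v c) (allFin n) ^ (4 * k′) * (a ^ ∑ (λ v → χ (equal? v c)) (allFin n) * b ^ k′) ^ N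
                   ≤ (d ^ k′ * b ^ n * e ^ ∑ (λ v → χ (equal? v c)) (allFin n)) ^ N
    coloring-bound = ∏-vertices {a} {b} {d} {e} {E = 4 * k′} {N} {k′} {n} (allFin n) (λ v → Φ v c) (λ v → χ (equal? v c)) (λ v → χ (designated? v))
      ∑-designated (length-allFin n) vertex-bound

  Cs = cols G k′

  U : ℕ
  U = ∑ (λ c → ∑ (λ v → χ (equal? v c)) (allFin n)) Cs

  entropy-orders : (P ^ P) ^ N ≤ ∏ (λ c → ∏ (λ v → Φ v c) (allFin n)) Cs
  entropy-orders = begin
    (P ^ P) ^ N
      ≡⟨ ≡-sym (∏-const (P ^ P) (orders n)) ⟩
    ∏ (λ _ → P ^ P) (orders n)
      ≤⟨ ∏-mono-∈ (orders n) (λ ω ω∈ → entropy G k′ (position ω) (orders-injective ω∈)) ⟩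
    ∏ (λ ω → ∏ (λ c → ∏ (λ v → avail G (position ω) c v) (allFin n)) Cs) (orders n)
      ≡⟨ ∏-swap (λ ω c → ∏ (λ v → avail G (position ω) c v) (allFin n)) (orders n) Cs ⟩
    ∏ (λ c → ∏ (λ ω → ∏ (λ v → avail G (position ω) c v) (allFin n)) (orders n)) Cs
      ≡⟨ ∏-cong Cs (λ c → ∏-swap (λ ω v → avail G (position ω) c v) (orders n) (allFin n)) ⟩
    ∏ (λ c → ∏ (λ v → Φ v c) (allFin n)) Cs ∎
    where open ≤-Reasoning

  -- After a P-th root and division this reads P^4 ≤ K^4 M^(n-k) (m/p)^(U/P): designated vertices
  -- contribute K^4, all others M each, and `U / P` is the average number of monochromatic triples
  -- in a colouring.
  counting : (P ^ 4) ^ P * p ^ U * (M ^ k′) ^ P ≤ (K ^ 4) ^ P * (M ^ n) ^ P * m ^ U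
  counting = extract-roots {P} {K} {M} {p} {m} {k′} {n} {U} {∏ (λ c → ∏ (λ v → Φ v c) (allFin n)) Cs} N {{>-nonZero (orders>0 n)}} entropy-orders
    (∏-colorings {a} {b} {d} {e} {E = 4 * k′} {N} {b ^ k′} {d ^ k′ * b ^ n} Cs (λ c → ∏ (λ v → Φ v c) (allFin n)) (λ c → ∑ (λ v → χ (equal? v c)) (allFin n))
      (λ c c∈ → coloring-bound c (cols-proper G c∈)))

  ∑-equal-≤ : ∀ B → (∀ v → m * (m * ∑ (λ c → χ (equal? v c)) (allVecs n k′)) ≤ B) → m * (m * U) ≤ n * B
  ∑-equal-≤ B le = begin
    m * (m * U)
      ≡⟨ cong (λ t → m * (m * t)) (∑-swap (λ c v → χ (equal? v c)) Cs (allFin n)) ⟩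
    m * (m * ∑ (λ v → ∑ (λ c → χ (equal? v c)) Cs) (allFin n))
      ≤⟨ *-monoʳ-≤ m (*-monoʳ-≤ m (∑-mono (allFin n) (λ v → cols≤ v))) ⟩
    m * (m * ∑ E (allFin n))
      ≡⟨ trans (cong (m *_) (≡-sym (∑-*ˡ m E (allFin n)))) (≡-sym (∑-*ˡ m (λ v → m * E v) (allFin n))) ⟩
    ∑ (λ v → m * (m * E v)) (allFin n)
      ≤⟨ ∑-mono (allFin n) le ⟩
    ∑ (λ _ → B) (allFin n)
      ≡⟨ trans (∑-const B (allFin n)) (cong (_* B) (length-allFin n)) ⟩
    n * B ∎
    where
    open ≤-Reasoning
    E : Fin n → ℕ
    E v = ∑ (λ c → χ (equal? v c)) (allVecs n k′)
    cols≤ : ∀ v → ∑ (λ c → χ (equal? v c)) Cs ≤ E v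
    cols≤ v = ≤-trans (≤-reflexive (∑-cols G (λ c → χ (equal? v c))))
      (∑-mono (allVecs n k′) (λ c → ≤-trans (*-monoˡ-≤ (χ (equal? v c)) (χ≤1 (proper? G c))) (≤-reflexive (*-identityˡ _))))

-- The final estimate

-- Bernoulli for the ratio (z+1)/z gives (1 + 1/z)^(z+1) ≥ 2 + 1/z. This is the origin of the base 2
-- in `n-large`.
2*n^[1+n]<[1+n]^[1+n] : ∀ z → 0 < z → 2 * z ^ suc z < suc z ^ suc z
2*n^[1+n]<[1+n]^[1+n] z 0<z = +-cancelʳ-< (z * z ^ suc z) _ _ (begin-strict
  2 * z ^ suc z + z * z ^ suc z            <⟨ m<m+n _ (m^n>0 z {{>-nonZero 0<z}} z) ⟩
  2 * z ^ suc z + z * z ^ suc z + z ^ z    ≡⟨ lem z (z ^ z) ⟩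
  suc z * (suc z * z ^ z)                  ≤⟨ bernoulli (suc z) z z ⟩
  suc z ^ suc z + z * z ^ suc z            ∎)
  where
  open ≤-Reasoning
  lem : ∀ z Z → 2 * (z * Z) + z * (z * Z) + Z ≡ suc z * (suc z * Z)
  lem = solve-∀

module Contradiction {p r n P U : ℕ} (0<p : 0 < p) (0<r : 0 < r) (0<P : 0 < P)
  (U-small : suc p * (suc p * U) ≤ n * P) (n-large : suc p ^ n ≤ 2 ^ r * p ^ n) where

  private
    m z q : ℕ
    m = suc p
    -- `z` is m² - 1, and `M` is m² z; compared with m⁴, an ordinary vertex therefore gains the
    -- ratio z / (z + 1).
    z = p * (2 + p)
    q = r * P
    instance
      p≢0 : NonZero p
      p≢0 = >-nonZero 0<p
      q≢0 : NonZero q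
      q≢0 = >-nonZero (*-mono-≤ 0<r 0<P)
    z+1≡m² : suc z ≡ m * m
    z+1≡m² = lem p
      where
      lem : ∀ p → suc (p * (2 + p)) ≡ suc p * suc p
      lem = solve-∀

  -- U(z+1) ≤ nP since z + 1 = m², hence (m/p)^(U(z+1)) ≤ (m/p)^(nP) ≤ 2^(rP).
  ratio-≤ : m ^ (U * suc z) ≤ 2 ^ q * p ^ (U * suc z)
  ratio-≤ = *-cancelʳ-≤ _ _ (p ^ (n * P)) {{m^n≢0 p (n * P)}} (begin
    m ^ V * p ^ (n * P)              ≡⟨ cong (λ t → m ^ V * p ^ t) (≡-sym V+w) ⟩
    m ^ V * p ^ (V + w)              ≡⟨ cong (m ^ V *_) (^-distribˡ-+-* p V w) ⟩
    m ^ V * (p ^ V * p ^ w)          ≤⟨ *-monoʳ-≤ (m ^ V) (*-monoʳ-≤ (p ^ V) (^-monoˡ-≤ w (n≤1+n p))) ⟩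
    m ^ V * (p ^ V * m ^ w)          ≡⟨ lem (m ^ V) (p ^ V) (m ^ w) ⟩
    p ^ V * (m ^ V * m ^ w)          ≡⟨ cong (p ^ V *_) (trans (≡-sym (^-distribˡ-+-* m V w)) (cong (m ^_) V+w)) ⟩
    p ^ V * m ^ (n * P)              ≡⟨ cong (p ^ V *_) (≡-sym (^-*-assoc m n P)) ⟩
    p ^ V * (m ^ n) ^ P              ≤⟨ *-monoʳ-≤ (p ^ V) (^-monoˡ-≤ P n-large) ⟩
    p ^ V * (2 ^ r * p ^ n) ^ P      ≡⟨ cong (p ^ V *_) (trans (^-distribʳ-* (2 ^ r) (p ^ n) P) (cong₂ _*_ (^-*-assoc 2 r P) (^-*-assoc p n P))) ⟩
    p ^ V * (2 ^ q * p ^ (n * P))    ≡⟨ lem₂ (p ^ V) (2 ^ q) (p ^ (n * P)) ⟩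
    2 ^ q * p ^ V * p ^ (n * P)      ∎)
    where
    open ≤-Reasoning
    V = U * suc z
    w = n * P ∸ V
    V≤ : V ≤ n * P
    V≤ = subst (_≤ n * P) (trans (lem₁ m U) (cong (U *_) (≡-sym z+1≡m²))) U-small
      where
      lem₁ : ∀ m U → m * (m * U) ≡ U * (m * m)
      lem₁ = solve-∀
    V+w : V + w ≡ n * P
    V+w = m+[n∸m]≡n V≤
    lem : ∀ a b c → a * (b * c) ≡ b * (a * c)
    lem = solve-∀
    lem₂ : ∀ a b c → a * (b * c) ≡ b * a * c
    lem₂ = solve-∀

  -- The inequality would mean ((z+1)/z)^q ≤ (m/p)^U. Raised to the power z + 1, its left side
  -- exceeds 2^q, while by `ratio-≤` its right side does not.
  ¬estimate : ¬ (m * m) ^ q * p ^ U ≤ z ^ q * m ^ U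
  ¬estimate le = <⇒≱ reversed raised
    where
    open ≤-Reasoning
    raise : ∀ x y → (x ^ q * y ^ U) ^ suc z ≡ (x ^ suc z) ^ q * y ^ (U * suc z)
    raise x y = trans (^-distribʳ-* (x ^ q) (y ^ U) (suc z)) (cong₂ _*_ (^-comm x q (suc z)) (^-*-assoc y U (suc z)))
    raised : (suc z ^ suc z) ^ q * p ^ (U * suc z) ≤ (z ^ suc z) ^ q * m ^ (U * suc z)
    raised = begin
      (suc z ^ suc z) ^ q * p ^ (U * suc z)   ≡⟨ ≡-sym (raise (suc z) p) ⟩
      (suc z ^ q * p ^ U) ^ suc z             ≤⟨ ^-monoˡ-≤ (suc z) (subst (λ t → t ^ q * p ^ U ≤ z ^ q * m ^ U) (≡-sym z+1≡m²) le) ⟩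
      (z ^ q * m ^ U) ^ suc z                 ≡⟨ raise z m ⟩
      (z ^ suc z) ^ q * m ^ (U * suc z)       ∎
    reversed : (z ^ suc z) ^ q * m ^ (U * suc z) < (suc z ^ suc z) ^ q * p ^ (U * suc z)
    reversed = begin-strict
      (z ^ suc z) ^ q * m ^ (U * suc z)             ≤⟨ *-monoʳ-≤ ((z ^ suc z) ^ q) ratio-≤ ⟩
      (z ^ suc z) ^ q * (2 ^ q * p ^ (U * suc z))   ≡⟨ lem ((z ^ suc z) ^ q) (2 ^ q) (p ^ (U * suc z)) ⟩
      2 ^ q * (z ^ suc z) ^ q * p ^ (U * suc z)     ≡⟨ cong (_* p ^ (U * suc z)) (≡-sym (^-distribʳ-* 2 (z ^ suc z) q)) ⟩
      (2 * z ^ suc z) ^ q * p ^ (U * suc z)         <⟨ *-monoˡ-< (p ^ (U * suc z)) {{m^n≢0 p (U * suc z)}} (^-monoˡ-< q (2*n^[1+n]<[1+n]^[1+n] z (*-mono-≤ 0<p (s≤s z≤n)))) ⟩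
      (suc z ^ suc z) ^ q * p ^ (U * suc z)         ∎
      where
      lem : ∀ a b c → a * (b * c) ≡ b * a * c
      lem = solve-∀

  -- Cancelling K, M^k and the powers of m common to both sides.
  ¬counting : ∀ K M k → 0 < K → p * (m * (m * ((2 + p) * 1))) ≡ M → n ≡ k + r → K * m ^ r ≤ P →
    ¬ (P ^ 4) ^ P * p ^ U * (M ^ k) ^ P ≤ (K ^ 4) ^ P * (M ^ n) ^ P * m ^ U
  ¬counting K M k 0<K M≡ refl B≤P le = ¬estimate (*-cancelˡ-≤ ((m * m) ^ q) {{m^n≢0 (m * m) q}} (*-cancelˡ-≤ common {{common≢0}} (begin
    common * ((m * m) ^ q * ((m * m) ^ q * p ^ U))
      ≡⟨ lem₁ ((K ^ 4) ^ P) ((M ^ k) ^ P) ((m * m) ^ q) (p ^ U) ⟩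
    (K ^ 4) ^ P * ((m * m) ^ q * (m * m) ^ q) * p ^ U * (M ^ k) ^ P
      ≡⟨ cong (λ t → (K ^ 4) ^ P * t * p ^ U * (M ^ k) ^ P) powers ⟩
    (K ^ 4) ^ P * ((m ^ r) ^ 4) ^ P * p ^ U * (M ^ k) ^ P
      ≡⟨ cong (λ t → t * p ^ U * (M ^ k) ^ P) (trans (≡-sym (^-distribʳ-* (K ^ 4) ((m ^ r) ^ 4) P)) (cong (_^ P) (≡-sym (^-distribʳ-* K (m ^ r) 4)))) ⟩
    ((K * m ^ r) ^ 4) ^ P * p ^ U * (M ^ k) ^ P
      ≤⟨ *-monoˡ-≤ ((M ^ k) ^ P) (*-monoˡ-≤ (p ^ U) (^-monoˡ-≤ P (^-monoˡ-≤ 4 B≤P))) ⟩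
    (P ^ 4) ^ P * p ^ U * (M ^ k) ^ P
      ≤⟨ le ⟩
    (K ^ 4) ^ P * (M ^ (k + r)) ^ P * m ^ U
      ≡⟨ cong (λ t → (K ^ 4) ^ P * t * m ^ U) split ⟩
    (K ^ 4) ^ P * ((M ^ k) ^ P * ((m * m) ^ q * z ^ q)) * m ^ U
      ≡⟨ lem₂ ((K ^ 4) ^ P) ((M ^ k) ^ P) ((m * m) ^ q) (z ^ q) (m ^ U) ⟩
    common * ((m * m) ^ q * (z ^ q * m ^ U)) ∎)))
    where
    open ≤-Reasoning
    common = (K ^ 4) ^ P * (M ^ k) ^ P
    0<M : 0 < M
    0<M = subst (0 <_) M≡ (*-mono-≤ 0<p (s≤s z≤n))
    common≢0 : NonZero common
    common≢0 = m*n≢0 _ _ {{m^n≢0 (K ^ 4) P {{m^n≢0 K 4 {{>-nonZero 0<K}}}}}} {{m^n≢0 (M ^ k) P {{m^n≢0 M k {{>-nonZero 0<M}}}}}}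
    lem₁ : ∀ a b c d → a * b * (c * (c * d)) ≡ a * (c * c) * d * b
    lem₁ = solve-∀
    lem₂ : ∀ a b c d e → a * (b * (c * d)) * e ≡ a * b * (c * (d * e))
    lem₂ = solve-∀
    powers : (m * m) ^ q * (m * m) ^ q ≡ ((m ^ r) ^ 4) ^ P
    powers = begin-equality
      (m * m) ^ q * (m * m) ^ q     ≡⟨ ≡-sym (^-distribʳ-* (m * m) (m * m) q) ⟩
      (m * m * (m * m)) ^ q         ≡⟨ cong (_^ q) (fourth m) ⟩
      (m ^ 4) ^ (r * P)             ≡⟨ ≡-sym (^-*-assoc (m ^ 4) r P) ⟩
      ((m ^ 4) ^ r) ^ P             ≡⟨ cong (_^ P) (^-comm m 4 r) ⟩
      ((m ^ r) ^ 4) ^ P             ∎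
      where
      fourth : ∀ m → m * m * (m * m) ≡ m * (m * (m * (m * 1)))
      fourth = solve-∀
    split : (M ^ (k + r)) ^ P ≡ (M ^ k) ^ P * ((m * m) ^ q * z ^ q)
    split = begin-equality
      (M ^ (k + r)) ^ P                        ≡⟨ cong (_^ P) (^-distribˡ-+-* M k r) ⟩
      (M ^ k * M ^ r) ^ P                      ≡⟨ ^-distribʳ-* (M ^ k) (M ^ r) P ⟩
      (M ^ k) ^ P * (M ^ r) ^ P                ≡⟨ cong ((M ^ k) ^ P *_) (^-*-assoc M r P) ⟩
      (M ^ k) ^ P * M ^ q                      ≡⟨ cong (λ t → (M ^ k) ^ P * t ^ q) (trans (≡-sym M≡) (factor p)) ⟩
      (M ^ k) ^ P * (m * m * z) ^ q            ≡⟨ cong ((M ^ k) ^ P *_) (^-distribʳ-* (m * m) z q) ⟩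
      (M ^ k) ^ P * ((m * m) ^ q * z ^ q)      ∎
      where
      factor : ∀ p → p * (suc p * (suc p * ((2 + p) * 1))) ≡ suc p * suc p * (p * (2 + p))
      factor = solve-∀

-- Assembly and the numerical thresholds

no-large-counterexample : ∀ p r n → 2 ≤ p → 2 ≤ r → n ≡ (2 + p) + r → suc p ^ n ≤ 2 ^ r * p ^ n →
  (G : Graph n) → Counterexample (2 + p) G → Minimal (2 + p) n → ⊥
no-large-counterexample p r n@(suc (suc n′)) 2≤p 2≤r n≡ n-large G ce@(con , (_ , ¬col) , _) min =
  ¬counting K M k′ (1≤n! k′) refl n≡ (subst (λ t → K * suc p ^ t ≤ P) n∸k≡r (counterexample-≥ {G = G} ce)) counting
  where
  open Counting G (¬col (suc p) ≤-refl) (three-neighbours (s≤s 2≤p) G ce min)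
  n∸k≡r : n ∸ k′ ≡ r
  n∸k≡r = trans (cong (_∸ k′) n≡) (m+n∸m≡n k′ r)
  nb : ∀ v → ThreeNeighbours G v
  nb = three-neighbours (s≤s 2≤p) G ce min
  0<P : 0 < P
  0<P = ≤-trans (bound>0 (suc p) n) (counterexample-≥ {G = G} ce)
  U-small : suc p * (suc p * U) ≤ n * P
  U-small = ∑-equal-≤ P λ v → let (_ , _ , _ , _ , x≢y , x≢z , y≢z) = nb v in
    ≤-trans (count-equal₃-≤ (minimal-bounded min (m≤n⇒m≤1+n ≤-refl)) G con (¬col (suc p) ≤-refl) x≢y x≢z y≢z)
            (counterexample-≥ {G = G} ce)
  open Contradiction {p} {r} {n} {P} {U} (≤-trans (s≤s z≤n) 2≤p) (≤-trans (s≤s z≤n) 2≤r) 0<P U-small n-large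
no-large-counterexample p r (suc zero) _ _ ()
no-large-counterexample p r zero _ _ ()

-- The instance p = 2, n = 13 + j, r = n - 4 of `n-large`: each further vertex multiplies the left
-- side by 3 and the right side by 4.
large-4 : ∀ j → 3 ^ (13 + j) ≤ 2 ^ (9 + j) * 2 ^ (13 + j)
large-4 zero    = ≤ᵇ⇒≤ (3 ^ 13) (2 ^ 9 * 2 ^ 13) _
large-4 (suc j) = begin
  3 * 3 ^ (13 + j)                              ≤⟨ *-mono-≤ {3} {4} (s≤s (s≤s (s≤s z≤n))) (large-4 j) ⟩
  4 * (2 ^ (9 + j) * 2 ^ (13 + j))              ≡⟨ lem (2 ^ (9 + j)) (2 ^ (13 + j)) ⟩
  2 * 2 ^ (9 + j) * (2 * 2 ^ (13 + j))          ∎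
  where
  open ≤-Reasoning
  lem : ∀ a b → 4 * (a * b) ≡ 2 * a * (2 * b)
  lem = solve-∀

-- This is (4/3)^(2r+1) ≤ 2^r for r = 4 + j; raising r by one multiplies the sides by 16/9 and by 2.
4^≤3^2^ : ∀ j → 4 ^ (9 + 2 * j) ≤ 3 ^ (9 + 2 * j) * 2 ^ (4 + j)
4^≤3^2^ zero    = ≤ᵇ⇒≤ (4 ^ 9) (3 ^ 9 * 2 ^ 4) _
4^≤3^2^ (suc j) = begin
  4 ^ (9 + 2 * suc j)                           ≡⟨ cong (4 ^_) (shift j) ⟩
  4 * (4 * 4 ^ (9 + 2 * j))                     ≡⟨ lem₁ (4 ^ (9 + 2 * j)) ⟩
  16 * 4 ^ (9 + 2 * j)                          ≤⟨ *-mono-≤ {16} {18} (m≤m+n 16 2) (4^≤3^2^ j) ⟩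
  18 * (3 ^ (9 + 2 * j) * 2 ^ (4 + j))          ≡⟨ lem₂ (3 ^ (9 + 2 * j)) (2 ^ (4 + j)) ⟩
  3 * (3 * 3 ^ (9 + 2 * j)) * (2 * 2 ^ (4 + j)) ≡⟨ cong (λ t → 3 ^ t * 2 ^ (5 + j)) (≡-sym (shift j)) ⟩
  3 ^ (9 + 2 * suc j) * 2 ^ (5 + j)             ∎
  where
  open ≤-Reasoning
  shift : ∀ j → 9 + 2 * suc j ≡ 2 + (9 + 2 * j)
  shift = solve-∀
  lem₁ : ∀ a → 4 * (4 * a) ≡ 16 * a
  lem₁ = solve-∀
  lem₂ : ∀ a b → 18 * (a * b) ≡ 3 * (3 * a) * (2 * b)
  lem₂ = solve-∀

-- For p ≥ 3 the ratio (p+1)/p is at most 4/3, and n is at most the exponent 2r + 1 covered by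
-- `4^≤3^2^`.
large-5 : ∀ p r n → 3 ≤ p → 4 ≤ r → n ≤ suc (2 * r) → suc p ^ n ≤ 2 ^ r * p ^ n
large-5 p r n 3≤p 4≤r n≤ = *-cancelˡ-≤ (3 ^ n) {{m^n≢0 3 n}} (begin
  3 ^ n * suc p ^ n             ≡⟨ ≡-sym (^-distribʳ-* 3 (suc p) n) ⟩
  (3 * suc p) ^ n               ≤⟨ ^-monoˡ-≤ n 3m≤4p ⟩
  (4 * p) ^ n                   ≡⟨ ^-distribʳ-* 4 p n ⟩
  4 ^ n * p ^ n                 ≤⟨ *-monoˡ-≤ (p ^ n) 4^n≤ ⟩
  3 ^ n * 2 ^ r * p ^ n         ≡⟨ *-assoc (3 ^ n) (2 ^ r) (p ^ n) ⟩
  3 ^ n * (2 ^ r * p ^ n)       ∎)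
  where
  open ≤-Reasoning
  3m≤4p : 3 * suc p ≤ 4 * p
  3m≤4p = begin
    3 * suc p     ≡⟨ *-suc 3 p ⟩
    3 + 3 * p     ≤⟨ +-monoˡ-≤ (3 * p) 3≤p ⟩
    4 * p         ∎
  j = r ∸ 4
  w = suc (2 * r) ∸ n
  n+w : n + w ≡ 9 + 2 * j
  n+w = trans (m+[n∸m]≡n n≤) (trans (cong (λ t → suc (2 * t)) (≡-sym (m+[n∸m]≡n 4≤r))) (lem j))
    where
    lem : ∀ j → suc (2 * (4 + j)) ≡ 9 + 2 * j
    lem = solve-∀
  4^n≤ : 4 ^ n ≤ 3 ^ n * 2 ^ r
  4^n≤ = *-cancelʳ-≤ _ _ (4 ^ w) {{m^n≢0 4 w}} (begin
    4 ^ n * 4 ^ w                ≡⟨ trans (≡-sym (^-distribˡ-+-* 4 n w)) (cong (4 ^_) n+w) ⟩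
    4 ^ (9 + 2 * j)              ≤⟨ 4^≤3^2^ j ⟩
    3 ^ (9 + 2 * j) * 2 ^ (4 + j) ≡⟨ cong₂ (λ s t → 3 ^ s * 2 ^ t) (≡-sym n+w) (m+[n∸m]≡n 4≤r) ⟩
    3 ^ (n + w) * 2 ^ r          ≡⟨ cong (_* 2 ^ r) (^-distribˡ-+-* 3 n w) ⟩
    3 ^ n * 3 ^ w * 2 ^ r        ≤⟨ *-monoˡ-≤ (2 ^ r) (*-monoʳ-≤ (3 ^ n) (^-monoˡ-≤ w (n≤1+n 3))) ⟩
    3 ^ n * 4 ^ w * 2 ^ r        ≡⟨ lem (3 ^ n) (4 ^ w) (2 ^ r) ⟩
    3 ^ n * 2 ^ r * 4 ^ w        ∎)
    where
    lem : ∀ a b c → a * b * c ≡ a * c * b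
    lem = solve-∀

theorem10 : (k : ℕ) → 4 ≤ k →
    Σ ℕ (λ m → Σ (Graph m) (Counterexample k)) →
    (n : ℕ) (G : Graph n) → Bad k G →
    (k ≡ 4 × n ≤ 12) ⊎ (5 ≤ k × n ≤ 2 * k ∸ 2)
theorem10 zero ()
theorem10 (suc zero) (s≤s ())
theorem10 (suc (suc zero)) (s≤s (s≤s ()))
theorem10 (suc (suc (suc zero))) (s≤s (s≤s (s≤s ())))
theorem10 4 _ _ n G (ce , (_ , min) , _) = inj₁ (refl , ≮⇒≥ λ 13≤n →
  no-large-counterexample 2 (n ∸ 4) n ≤-refl (≤-trans (s≤s (s≤s z≤n)) (∸-monoˡ-≤ 4 13≤n))
    (≡-sym (m+[n∸m]≡n (≤-trans (m≤m+n 4 9) 13≤n))) (large 13≤n) G ce min)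
  where
  large : ∀ {n} → 13 ≤ n → 3 ^ n ≤ 2 ^ (n ∸ 4) * 2 ^ n
  large {n} 13≤n = subst (λ t → 3 ^ t ≤ 2 ^ (t ∸ 4) * 2 ^ t) (m+[n∸m]≡n 13≤n) (large-4 (n ∸ 13))
theorem10 k@(suc (suc p@(suc (suc (suc _))))) _ _ n G (ce , (_ , min) , _) = inj₂ (s≤s (s≤s (s≤s (s≤s (s≤s z≤n)))) , ≮⇒≥ λ 2k-2<n →
  -- From n ≥ 2k - 1 comes r = n - k ≥ k - 1, hence n = k + r ≤ 2r + 1; and k ≥ 5 makes r at least
  -- 4.
  let k-1≤r : suc p ≤ n ∸ k
      k-1≤r = m+n≤o⇒m≤o∸n (suc p) (≤-trans (≤-reflexive (shift p)) 2k-2<n)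
      k≤n : k ≤ n
      k≤n = ≤-trans (m≤n+m k (suc p)) (≤-trans (≤-reflexive (shift p)) 2k-2<n)
      4≤r : 4 ≤ n ∸ k
      4≤r = ≤-trans (s≤s (s≤s (s≤s (s≤s z≤n)))) k-1≤r
  in no-large-counterexample p (n ∸ k) n (s≤s (s≤s z≤n)) (≤-trans (s≤s (s≤s z≤n)) 4≤r) (≡-sym (m+[n∸m]≡n k≤n))
       (large-5 p (n ∸ k) n (s≤s (s≤s (s≤s z≤n))) 4≤r (n≤2r+1 k-1≤r k≤n)) G ce min)
  where
  shift : ∀ p → suc p + (2 + p) ≡ suc (2 * (2 + p) ∸ 2)
  shift p = cong suc (lem p)
    where
    lem : ∀ p → p + (2 + p) ≡ p + suc (suc (p + 0))
    lem = solve-∀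
  n≤2r+1 : suc p ≤ n ∸ k → k ≤ n → n ≤ suc (2 * (n ∸ k))
  n≤2r+1 le k≤n = begin
    n                              ≡⟨ ≡-sym (m+[n∸m]≡n k≤n) ⟩
    k + (n ∸ k)                    ≤⟨ +-monoˡ-≤ (n ∸ k) (s≤s le) ⟩
    suc (n ∸ k) + (n ∸ k)          ≡⟨ lem (n ∸ k) ⟩
    suc (2 * (n ∸ k))              ∎
    where
    open ≤-Reasoning
    lem : ∀ r → suc r + r ≡ suc (2 * r)
    lem = solve-∀
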